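{- For each polynomial-time computable function $f\colon\mathbb N^\ell\to\mathbb N$ there is a closed $\mathsf{BCL}$ expression $e_f$ with $\vdash e_f\colon(\mathrm N_{\mathrm{norm}},\dots,\mathrm N_{\mathrm{norm}})\to\mathrm N_{\mathrm{safe}}$ ($\ell$ arguments) whose denotation is $f$.
   Context: Natural numbers are identified with binary strings in $\{\mathbf 0,\mathbf 1\}^*$ via dyadic notation; $|v|$ is the length of $v$, $\epsilon$ the empty string, $a\oplus v$ concatenation. $\mathsf{BCL}$ raw expressions: $e::= k \mid (\mathsf c_{\mathbf 0}\,e)\mid(\mathsf c_{\mathbf 1}\,e)\mid(\mathsf d\,e)\mid(\mathsf t_{\mathbf 0}\,e)\mid(\mathsf t_{\mathbf 1}\,e)\mid(\mathsf{down}\,e\,e)\mid x\mid(e\,e)\mid(\lambda x.e)\mid(\mathsf{If}\,e\,\mathsf{then}\,e\,\mathsf{else}\,e)\mid(\mathsf{prn}\,e)$, $k$ ranging over strings, all variables of base type. Types: level-0 and level-1 simple types over base types $\mathrm N_{\mathrm{norm}},\mathrm N_{\mathrm{safe}}$, with subtyping generated by $\mathrm N_{\mathrm{norm}}<:\mathrm N_{\mathrm{safe}}$ and the usual arrow rule. Typing rules (contexts are finite maps from variables to types; $\cup$ = union of consistent contexts): variable rule; $\lambda$-introduction; application with contexts unioned; $\Gamma\vdash k\colon\mathrm N_{\mathrm{safe}}$ for constants $k$; $\Gamma\vdash\epsilon\colon\mathrm N_{\mathrm{norm}}$; each $\mathrm{op}\in\{\mathsf c_{\mathbf0},\mathsf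 c_{\mathbf1},\mathsf d,\mathsf t_{\mathbf0},\mathsf t_{\mathbf1}\}$ maps $\mathrm N_{\mathrm{safe}}$ to $\mathrm N_{\mathrm{safe}}$; $\mathsf d$ also maps $\mathrm N_{\mathrm{norm}}$ to $\mathrm N_{\mathrm{norm}}$; $\mathsf{down}$ and $\mathsf{If}$ take $\mathrm N_{\mathrm{safe}}$ arguments to $\mathrm N_{\mathrm{safe}}$; subsumption; from $\Gamma\vdash e\colon\mathrm N_{\mathrm{norm}}\to\mathrm N_{\mathrm{safe}}\to\mathrm N_{\mathrm{safe}}$ infer $\Gamma\vdash(\mathsf{prn}\,e)\colon\mathrm N_{\mathrm{norm}}\to\mathrm N_{\mathrm{safe}}$. Denotational semantics (both base types denote $\{\mathbf0,\mathbf1\}^*$): $\mathsf c_a v=a\oplus v$; $\mathsf d(a\oplus v)=v$, $\mathsf d\epsilon=\epsilon$; $\mathsf t_a v=\mathbf0$ if $v$ begins with $a$, else $\epsilon$; $\mathsf{down}\,v_0\,v_1=v_0$ if $|v_0|\le|v_1|$, else $\epsilon$; $\mathsf{If}$ selects the then-branch iff the test is nonempty; $\mathsf{prn}\,f\,\epsilon=f\,\epsilon\,\epsilon$, $\mathsf{prn}\,f\,(a\oplus y)=f\,(a\oplus y)\,(\mathsf{prn}\,f\,y)$. -}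

module Defs where

open import Data.Bool using (Bool; true; false; if_then_else_)
open import Data.Nat using (ℕ; zero; suc; _+_; _*_; _^_; _≤_; _≤ᵇ_; _≡ᵇ_)
open import Data.List using (List; []; _∷_; length; _++_)
open import Data.Vec using (Vec; []; _∷_)
open import Data.Fin using (Fin; zero; suc)
open import Data.Maybe using (Maybe; just; nothing)
open import Data.Product using (Σ; _×_; _,_)
open import Relation.Binary.PropositionalEquality using (_≡_)

-- Bit false = 𝟎, true = 𝟏.  The head of the list is
-- the first letter, so  a ⊕ v  is  a ∷ v .  Natural numbers are
-- identified with such strings (dyadic notation), so we work with
-- strings directly.

Bit : Set
Bit = Bool

Str : Set
Str = List Bit

𝟎 𝟏 : Bit
𝟎 = false
𝟏 = true

data Base : Set where
  norm safe : Base

infixr 5 _⇒_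
data Ty : Set where
  `_  : Base → Ty
  _⇒_ : Base → Ty → Ty

data _<:b_ : Base → Base → Set where
  <:b-refl : ∀ {b} → b <:b b
  norm<:safe : norm <:b safe

data _<:_ : Ty → Ty → Set where
  <:-base  : ∀ {b b'} → b <:b b' → (` b) <: (` b')
  <:-arrow : ∀ {σ σ' τ τ'} → σ' <:b σ → τ <: τ' → (σ ⇒ τ) <: (σ' ⇒ τ')

Var : Set
Var = ℕ

data Exp : Set where
  const : Str → Exp
  c₀ c₁ d t₀ t₁ : Exp → Exp
  down : Exp → Exp → Exp
  var  : Var → Exp
  app  : Exp → Exp → Exp
  lam  : Var → Exp → Exp
  If_then_else_ : Exp → Exp → Exp → Exp
  prn  : Exp → Exp

Ctx : Set
Ctx = Var → Maybe Base

∅ : Ctx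
∅ _ = nothing

_,,_∶_ : Ctx → Var → Base → Ctx
(Γ ,, x ∶ b) y = if y ≡ᵇ x then just b else Γ y

Consistent : Ctx → Ctx → Set
Consistent Γ Δ = ∀ x b b' → Γ x ≡ just b → Δ x ≡ just b' → b ≡ b'

_∪_ : Ctx → Ctx → Ctx
(Γ ∪ Δ) x with Γ x
... | just b  = just b
... | nothing = Δ x

IsUnion : Ctx → Ctx → Ctx → Set
IsUnion Γ Δ Θ = Consistent Γ Δ × (∀ x → Θ x ≡ (Γ ∪ Δ) x)

IsUnion3 : Ctx → Ctx → Ctx → Ctx → Set
IsUnion3 Γ Δ Ξ Θ =
  Consistent Γ Δ × Consistent Γ Ξ × Consistent Δ Ξ ×
  (∀ x → Θ x ≡ ((Γ ∪ Δ) ∪ Ξ) x)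

infix 4 _⊢_∶_
data _⊢_∶_ : Ctx → Exp → Ty → Set where
  ty-var   : ∀ {Γ x b} → Γ x ≡ just b → Γ ⊢ var x ∶ ` b
  ty-lam   : ∀ {Γ x b e τ} → (Γ ,, x ∶ b) ⊢ e ∶ τ → Γ ⊢ lam x e ∶ b ⇒ τ
  ty-app   : ∀ {Γ Δ Θ e₁ e₂ b τ} → IsUnion Γ Δ Θ →
             Γ ⊢ e₁ ∶ b ⇒ τ → Δ ⊢ e₂ ∶ ` b → Θ ⊢ app e₁ e₂ ∶ τ
  ty-const : ∀ {Γ k} → Γ ⊢ const k ∶ ` safe
  ty-ε     : ∀ {Γ} → Γ ⊢ const [] ∶ ` norm
  ty-c₀    : ∀ {Γ e} → Γ ⊢ e ∶ ` safe → Γ ⊢ c₀ e ∶ ` safe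
  ty-c₁    : ∀ {Γ e} → Γ ⊢ e ∶ ` safe → Γ ⊢ c₁ e ∶ ` safe
  ty-d     : ∀ {Γ e} → Γ ⊢ e ∶ ` safe → Γ ⊢ d e ∶ ` safe
  ty-dn    : ∀ {Γ e} → Γ ⊢ e ∶ ` norm → Γ ⊢ d e ∶ ` norm
  ty-t₀    : ∀ {Γ e} → Γ ⊢ e ∶ ` safe → Γ ⊢ t₀ e ∶ ` safe
  ty-t₁    : ∀ {Γ e} → Γ ⊢ e ∶ ` safe → Γ ⊢ t₁ e ∶ ` safe
  ty-down  : ∀ {Γ Δ Θ e₁ e₂} → IsUnion Γ Δ Θ →
             Γ ⊢ e₁ ∶ ` safe → Δ ⊢ e₂ ∶ ` safe → Θ ⊢ down e₁ e₂ ∶ ` safe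
  ty-If    : ∀ {Γ Δ Ξ Θ e₁ e₂ e₃} → IsUnion3 Γ Δ Ξ Θ →
             Γ ⊢ e₁ ∶ ` safe → Δ ⊢ e₂ ∶ ` safe → Ξ ⊢ e₃ ∶ ` safe →
             Θ ⊢ If e₁ then e₂ else e₃ ∶ ` safe
  ty-sub   : ∀ {Γ e σ τ} → Γ ⊢ e ∶ σ → σ <: τ → Γ ⊢ e ∶ τ
  ty-prn   : ∀ {Γ e} → Γ ⊢ e ∶ norm ⇒ safe ⇒ ` safe → Γ ⊢ prn e ∶ norm ⇒ ` safe

⟦_⟧ : Ty → Set
⟦ ` _ ⟧   = Str
⟦ _ ⇒ τ ⟧ = Str → ⟦ τ ⟧

coerce : ∀ {σ τ} → σ <: τ → ⟦ σ ⟧ → ⟦ τ ⟧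
coerce (<:-base _) v = v
coerce (<:-arrow _ t) f = λ v → coerce t (f v)

sem-d : Str → Str
sem-d []      = []
sem-d (_ ∷ v) = v

sem-t : Bit → Str → Str
sem-t a []      = []
sem-t false (false ∷ _) = 𝟎 ∷ []
sem-t false (true ∷ _)  = []
sem-t true  (true ∷ _)  = 𝟎 ∷ []
sem-t true  (false ∷ _) = []

sem-down : Str → Str → Str
sem-down v₀ v₁ = if length v₀ ≤ᵇ length v₁ then v₀ else []

sem-If : Str → Str → Str → Str
sem-If []      _ v₂ = v₂
sem-If (_ ∷ _) v₁ _ = v₁

sem-prn : (Str → Str → Str) → Str → Str
sem-prn f []        = f [] []
sem-prn f (a ∷ y)   = f (a ∷ y) (sem-prn f y)

Env : Set
Env = Var → Str

_[_↦_] : Env → Var → Str → Env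
(ρ [ x ↦ v ]) y = if y ≡ᵇ x then v else ρ y

eval : ∀ {Γ e τ} → Γ ⊢ e ∶ τ → Env → ⟦ τ ⟧
eval (ty-var {x = x} _) ρ = ρ x
eval (ty-lam {x = x} D) ρ = λ v → eval D (ρ [ x ↦ v ])
eval (ty-app _ D₁ D₂) ρ = eval D₁ ρ (eval D₂ ρ)
eval (ty-const {k = k}) ρ = k
eval ty-ε ρ = []
eval (ty-c₀ D) ρ = 𝟎 ∷ eval D ρ
eval (ty-c₁ D) ρ = 𝟏 ∷ eval D ρ
eval (ty-d D) ρ = sem-d (eval D ρ)
eval (ty-dn D) ρ = sem-d (eval D ρ)
eval (ty-t₀ D) ρ = sem-t 𝟎 (eval D ρ)
eval (ty-t₁ D) ρ = sem-t 𝟏 (eval D ρ)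
eval (ty-down _ D₁ D₂) ρ = sem-down (eval D₁ ρ) (eval D₂ ρ)
eval (ty-If _ D₁ D₂ D₃) ρ = sem-If (eval D₁ ρ) (eval D₂ ρ) (eval D₃ ρ)
eval (ty-sub D s) ρ = coerce s (eval D ρ)
eval (ty-prn D) ρ = sem-prn (eval D ρ)

⟦_⟧₀ : ∀ {e τ} → ∅ ⊢ e ∶ τ → ⟦ τ ⟧
⟦ D ⟧₀ = eval D (λ _ → [])

NormArrows : ℕ → Ty
NormArrows zero    = ` safe
NormArrows (suc ℓ) = norm ⇒ NormArrows ℓ

applyAll : ∀ {ℓ} → ⟦ NormArrows ℓ ⟧ → Vec Str ℓ → Str
applyAll v []       = v
applyAll f (x ∷ xs) = applyAll (f x) xs

-- Polynomial-time computability: deterministic single-tape Turing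
-- machines with a two-way infinite tape over the alphabet
-- Fin (4 + extra), where 0 = blank, 1 = '𝟎', 2 = '𝟏', 3 = separator '#'.

data Move : Set where
  L R S : Move

record TM : Set where
  field
    Q     : ℕ
    extra : ℕ
    start : Fin Q
    -- nothing = halt
    δ     : Fin Q → Fin (4 + extra) → Maybe (Fin Q × Fin (4 + extra) × Move)

module _ (M : TM) where
  open TM M

  Sym : Set
  Sym = Fin (4 + extra)

  blank sym0 sym1 sep : Sym
  blank = zero
  sym0  = suc zero
  sym1  = suc (suc zero)
  sep   = suc (suc (suc zero))

  record Config : Set where
    constructor conf
    field
      state : Fin Q
      left  : List Sym   -- cells to the left of the head, nearest first
      here  : Sym
      right : List Sym   -- cells to the right of the head, nearest first

  shift : Move → List Sym → Sym → List Sym → List Sym × Sym × List Sym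
  shift S ls h rs = ls , h , rs
  shift L []       h rs = [] , blank , (h ∷ rs)
  shift L (l ∷ ls) h rs = ls , l , (h ∷ rs)
  shift R ls h []       = (h ∷ ls) , blank , []
  shift R ls h (r ∷ rs) = (h ∷ ls) , r , rs

  step : Config → Config
  step (conf q ls h rs) with δ q h
  ... | nothing = conf q ls h rs
  ... | just (q' , w , m) with shift m ls w rs
  ...   | ls' , h' , rs' = conf q' ls' h' rs'

  run : ℕ → Config → Config
  run zero    c = c
  run (suc t) c = run t (step c)

  Halted : Config → Set
  Halted (conf q _ h _) = δ q h ≡ nothing

  readBits : List Sym → Str
  readBits []                          = []
  readBits (zero ∷ _)                  = []
  readBits (suc zero ∷ ss)             = 𝟎 ∷ readBits ss
  readBits (suc (suc zero) ∷ ss)       = 𝟏 ∷ readBits ss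
  readBits (suc (suc (suc _)) ∷ _)     = []

  output : Config → Str
  output (conf _ _ h rs) = readBits (h ∷ rs)

  encStr : Str → List Sym
  encStr []          = []
  encStr (false ∷ v) = sym0 ∷ encStr v
  encStr (true ∷ v)  = sym1 ∷ encStr v

  encInputs : ∀ {ℓ} → Vec Str ℓ → List Sym
  encInputs []           = []
  encInputs (x ∷ [])     = encStr x
  encInputs (x ∷ y ∷ xs) = encStr x ++ (sep ∷ encInputs (y ∷ xs))

  initConfig : ∀ {ℓ} → Vec Str ℓ → Config
  initConfig xs with encInputs xs
  ... | []     = conf start [] blank []
  ... | s ∷ ss = conf start [] s ss

totalLength : ∀ {ℓ} → Vec Str ℓ → ℕ
totalLength []       = 0
totalLength (x ∷ xs) = length x + totalLength xs

PolyTimeComputable : ∀ {ℓ} → (Vec Str ℓ → Str) → Set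
PolyTimeComputable {ℓ} f =
  Σ TM λ M → Σ ℕ λ c → Σ ℕ λ k → ∀ (xs : Vec Str ℓ) →
    Halted M (run M (c * suc (totalLength xs) ^ k) (initConfig M xs)) ×
    output M (run M (c * suc (totalLength xs) ^ k) (initConfig M xs)) ≡ f xs

module Submission where

-- A polynomial-time Turing machine is simulated as a cellular automaton.  A configuration
-- is a string of fixed-width cell codes (symbol, and the state at the head), and one machine
-- step is a local rule on neighbourhoods of three cells.  BCL applies such a rule to a whole
-- safe string by a loop that rebuilds it cell by cell, each new cell chosen by a decision
-- tree on the bits of its neighbourhood.  Nesting prn over the normal arguments gives loops
-- of length N^k for N = ∏ (|xᵢ| + 1) > Σ |xᵢ|, which bounds both the running time c·(n+1)^k
-- and the tape used; the accumulators of all loops are safe, so prn only ever recurses on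
-- the arguments.  The input is encoded cell by cell by a prn over each argument, and the
-- output bits are read off the final configuration by one more scan.

open import Data.Bool using (Bool; true; false; if_then_else_)
open import Data.Nat
open import Data.Nat.Properties
open import Data.List using (List; []; _∷_; length; _++_; drop)
open import Data.List.Properties using (++-assoc; ++-identityʳ; length-++; drop-[]; drop-drop; drop-all)
open import Data.Vec using (Vec; []; _∷_; lookup; toList; replicate)
import Data.Vec as Vec
open import Data.Vec.Properties using (toList-++; length-toList)
open import Data.Fin using (Fin; zero; suc; toℕ)
open import Data.Fin.Properties using (toℕ<n)
open import Data.Maybe using (Maybe; just; nothing)
open import Data.Maybe.Properties using (just-injective)
open import Data.Product using (Σ; _×_; _,_; proj₁; proj₂)
open import Data.Sum using (_⊎_; inj₁; inj₂)
open import Data.Empty using (⊥-elim)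
open import Relation.Nullary using (yes; no)
open import Function using (_∘_)
open import Relation.Binary.PropositionalEquality
open import Data.Nat.Tactic.RingSolver using (solve-∀)
open import Algebra.Properties.CommutativeSemigroup *-commutativeSemigroup using () renaming (x∙yz≈y∙xz to *-left-comm)

open import Defs

cong₃ : ∀ {A B C D : Set} (f : A → B → C → D) {a a′ b b′ c c′} →
  a ≡ a′ → b ≡ b′ → c ≡ c′ → f a b c ≡ f a′ b′ c′
cong₃ f refl refl refl = refl

≡ᵇ-refl : ∀ n → (n ≡ᵇ n) ≡ true
≡ᵇ-refl zero    = refl
≡ᵇ-refl (suc n) = ≡ᵇ-refl n

≢⇒≡ᵇ-false : ∀ m n → m ≢ n → (m ≡ᵇ n) ≡ false
≢⇒≡ᵇ-false zero    zero    m≢n = ⊥-elim (m≢n refl)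
≢⇒≡ᵇ-false zero    (suc n) m≢n = refl
≢⇒≡ᵇ-false (suc m) zero    m≢n = refl
≢⇒≡ᵇ-false (suc m) (suc n) m≢n = ≢⇒≡ᵇ-false m n (m≢n ∘ cong suc)

2+n≢n : ∀ (n : ℕ) → suc (suc n) ≢ n
2+n≢n zero    ()
2+n≢n (suc n) e = 2+n≢n n (suc-injective e)

m+n<o⇒n<o∸m : ∀ m {n o} → m + n < o → n < o ∸ m
m+n<o⇒n<o∸m zero    lt                     = lt
m+n<o⇒n<o∸m (suc m) {o = suc o} (s≤s lt) = m+n<o⇒n<o∸m m lt

∸-suc : ∀ {m n} → n < m → m ∸ n ≡ suc (m ∸ suc n)
∸-suc {suc m} (s≤s n≤m) = +-∸-assoc 1 n≤m

∪-agree : ∀ Γ Δ x → Γ x ≡ Δ x → (Γ ∪ Δ) x ≡ Δ x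
∪-agree Γ Δ x eq with Γ x
... | just _  = eq
... | nothing = refl

consistent-self : ∀ {Γ} → Consistent Γ Γ
consistent-self x b b′ p q = just-injective (trans (sym p) q)

isUnion-self : ∀ {Γ} → IsUnion Γ Γ Γ
isUnion-self {Γ} = consistent-self , λ x → sym (∪-agree Γ Γ x refl)

isUnion3-self : ∀ {Γ} → IsUnion3 Γ Γ Γ Γ
isUnion3-self {Γ} = consistent-self , consistent-self , consistent-self ,
  λ x → sym (∪-agree (Γ ∪ Γ) Γ x (∪-agree Γ Γ x refl))

norm⇒safe : ∀ {Γ e} → Γ ⊢ e ∶ ` norm → Γ ⊢ e ∶ ` safe
norm⇒safe D = ty-sub D (<:-base norm<:safe)

letE : Var → Exp → Exp → Exp
letE x e b = app (lam x b) e

⊢letE : ∀ {Γ x e b} → Γ ⊢ e ∶ ` safe → (Γ ,, x ∶ safe) ⊢ b ∶ ` safe → Γ ⊢ letE x e b ∶ ` safe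
⊢letE De Db = ty-app isUnion-self (ty-lam Db) De

⊢If : ∀ {Γ a b c} → Γ ⊢ a ∶ ` safe → Γ ⊢ b ∶ ` safe → Γ ⊢ c ∶ ` safe →
      Γ ⊢ If a then b else c ∶ ` safe
⊢If = ty-If isUnion3-self

dropE : ℕ → Exp → Exp
dropE zero    e = e
dropE (suc n) e = d (dropE n e)

⊢dropE : ∀ n {Γ e} → Γ ⊢ e ∶ ` safe → Γ ⊢ dropE n e ∶ ` safe
⊢dropE zero    D = D
⊢dropE (suc n) D = ty-d (⊢dropE n D)

sem-d∘drop : ∀ n (v : Str) → sem-d (drop n v) ≡ drop (suc n) v
sem-d∘drop zero    []      = refl
sem-d∘drop zero    (_ ∷ _) = refl
sem-d∘drop (suc n) []      = refl
sem-d∘drop (suc n) (_ ∷ v) = sem-d∘drop n v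

eval-dropE : ∀ n {Γ e} (D : Γ ⊢ e ∶ ` safe) ρ → eval (⊢dropE n D) ρ ≡ drop n (eval D ρ)
eval-dropE zero    D ρ = refl
eval-dropE (suc n) D ρ = trans (cong sem-d (eval-dropE n D ρ)) (sem-d∘drop n (eval D ρ))

prefixE : Str → Exp → Exp
prefixE []           e = e
prefixE (false ∷ bs) e = c₀ (prefixE bs e)
prefixE (true ∷ bs)  e = c₁ (prefixE bs e)

⊢prefixE : ∀ bs {Γ e} → Γ ⊢ e ∶ ` safe → Γ ⊢ prefixE bs e ∶ ` safe
⊢prefixE []           D = D
⊢prefixE (false ∷ bs) D = ty-c₀ (⊢prefixE bs D)
⊢prefixE (true ∷ bs)  D = ty-c₁ (⊢prefixE bs D)

eval-prefixE : ∀ bs {Γ e} (D : Γ ⊢ e ∶ ` safe) ρ → eval (⊢prefixE bs D) ρ ≡ bs ++ eval D ρ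
eval-prefixE []           D ρ = refl
eval-prefixE (false ∷ bs) D ρ = cong (false ∷_) (eval-prefixE bs D ρ)
eval-prefixE (true ∷ bs)  D ρ = cong (true ∷_) (eval-prefixE bs D ρ)

loop : ℕ → (ℕ → Str → Str) → Str → Str
loop zero    g s = s
loop (suc n) g s = g n (loop n g s)

loop-cong : ∀ n {g h : ℕ → Str → Str} {s t} → s ≡ t → (∀ p a → p < n → g p a ≡ h p a) →
  loop n g s ≡ loop n h t
loop-cong zero    s≡t g≗h = s≡t
loop-cong (suc n) {h = h} s≡t g≗h =
  trans (g≗h n _ ≤-refl) (cong (h n) (loop-cong n s≡t (λ p a p<n → g≗h p a (m≤n⇒m≤1+n p<n))))

loop-+ : ∀ m n g s → loop (m + n) g s ≡ loop n (λ p → g (m + p)) (loop m g s)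
loop-+ m zero    g s = cong (λ k → loop k g s) (+-identityʳ m)
loop-+ m (suc n) g s = trans (cong (λ k → loop k g s) (+-suc m n)) (cong (g (m + n)) (loop-+ m n g s))

loop-* : ∀ m n g s → loop (m * n) g s ≡ loop m (λ j → loop n (λ p → g (j * n + p))) s
loop-* zero    n g s = refl
loop-* (suc m) n g s = begin
  loop (n + m * n) g s                                   ≡⟨ cong (λ k → loop k g s) (+-comm n (m * n)) ⟩
  loop (m * n + n) g s                                   ≡⟨ loop-+ (m * n) n g s ⟩
  loop n (λ p → g (m * n + p)) (loop (m * n) g s)        ≡⟨ cong (loop n _) (loop-* m n g s) ⟩
  loop n (λ p → g (m * n + p)) (loop m (λ j → loop n (λ p → g (j * n + p))) s) ∎
  where open ≡-Reasoning

loop-drop : ∀ m k (v : Str) → loop m (λ _ → drop k) v ≡ drop (m * k) v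
loop-drop zero    k v = refl
loop-drop (suc m) k v = begin
  drop k (loop m (λ _ → drop k) v) ≡⟨ cong (drop k) (loop-drop m k v) ⟩
  drop k (drop (m * k) v)          ≡⟨ drop-drop (m * k) k v ⟩
  drop (m * k + k) v               ≡⟨ cong (λ j → drop j v) (+-comm (m * k) k) ⟩
  drop (k + m * k) v               ∎
  where open ≡-Reasoning

sem-prn-loop : ∀ (f : Str → Str → Str) (H : ℕ → Str → Str) s →
  (∀ v w → f v w ≡ H (length v) (sem-If v w s)) →
  ∀ x → sem-prn f x ≡ loop (suc (length x)) H s
sem-prn-loop f H s hyp []      = hyp [] []
sem-prn-loop f H s hyp (a ∷ x) =
  trans (hyp (a ∷ x) (sem-prn f x)) (cong (H (suc (length x))) (sem-prn-loop f H s hyp x))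

module Arguments (ℓ : ℕ) where

  argVar : Fin ℓ → Var
  argVar i = 10 + toℕ i

  ArgsNorm : Ctx → Set
  ArgsNorm Γ = ∀ i → Γ (argVar i) ≡ just norm

  ArgsAre : Env → Vec Str ℓ → Set
  ArgsAre ρ xs = ∀ i → ρ (argVar i) ≡ lookup xs i

  Lengths : Set
  Lengths = Fin ℓ → ℕ

  lengths : Env → Lengths
  lengths ρ i = length (ρ (argVar i))

  argLams : ℕ → ℕ → Exp → Exp
  argLams s zero    e = e
  argLams s (suc m) e = lam (10 + s) (argLams (suc s) m e)

  ArgsNormBelow : ℕ → Ctx → Set
  ArgsNormBelow s Γ = ∀ i → toℕ i < s → Γ (argVar i) ≡ just norm

  argsNormBelow-suc : ∀ s {Γ} → ArgsNormBelow s Γ → ArgsNormBelow (suc s) (Γ ,, 10 + s ∶ norm)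
  argsNormBelow-suc s {Γ} g↓ i i<1+s with toℕ i ≟ s
  ... | yes refl rewrite ≡ᵇ-refl s = refl
  ... | no i≢s   rewrite ≢⇒≡ᵇ-false (toℕ i) s i≢s = g↓ i (≤∧≢⇒< (≤-pred i<1+s) i≢s)

  ⊢Closed : Exp → Set
  ⊢Closed e = ∀ {Γ} → ArgsNorm Γ → Γ ⊢ e ∶ ` safe

  ⊢argLams : ∀ s m {Γ e} → ArgsNormBelow s Γ → s + m ≡ ℓ → ⊢Closed e → Γ ⊢ argLams s m e ∶ NormArrows m
  ⊢argLams s zero {Γ} g↓ s≡ℓ ⊢e =
    ⊢e {Γ} (λ i → g↓ i (subst (toℕ i <_) (trans (sym s≡ℓ) (+-identityʳ s)) (toℕ<n i)))
  ⊢argLams s (suc m) {Γ} g↓ s≡ℓ ⊢e =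
    ty-lam (⊢argLams (suc s) m (argsNormBelow-suc s {Γ} g↓) (trans (sym (+-suc s m)) s≡ℓ) ⊢e)

  bindArgs : Env → ℕ → ∀ {m} → Vec Str m → Env
  bindArgs ρ s []       = ρ
  bindArgs ρ s (y ∷ ys) = bindArgs (ρ [ 10 + s ↦ y ]) (suc s) ys

  applyAll-argLams : ∀ s m {Γ e} (g↓ : ArgsNormBelow s Γ) (s≡ℓ : s + m ≡ ℓ) (⊢e : ⊢Closed e) (P : Env → Set) out →
    (∀ {Γ′} (g↓′ : ArgsNorm Γ′) ρ′ → P ρ′ → eval (⊢e {Γ′} g↓′) ρ′ ≡ out) →
    ∀ ρ (ys : Vec Str m) → P (bindArgs ρ s ys) → applyAll (eval (⊢argLams s m {Γ} g↓ s≡ℓ ⊢e) ρ) ys ≡ out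
  applyAll-argLams s zero    g↓ s≡ℓ ⊢e P out ok ρ []       p = ok _ ρ p
  applyAll-argLams s (suc m) {Γ} g↓ s≡ℓ ⊢e P out ok ρ (y ∷ ys) p =
    applyAll-argLams (suc s) m (argsNormBelow-suc s {Γ} g↓) (trans (sym (+-suc s m)) s≡ℓ) ⊢e P out ok
                     (ρ [ 10 + s ↦ y ]) ys p

  bindArgs-below : ∀ s {m} ρ (ys : Vec Str m) j → j < s → bindArgs ρ s ys (10 + j) ≡ ρ (10 + j)
  bindArgs-below s ρ []       j j<s = refl
  bindArgs-below s ρ (y ∷ ys) j j<s
    rewrite bindArgs-below (suc s) (ρ [ 10 + s ↦ y ]) ys j (m≤n⇒m≤1+n j<s)
          | ≢⇒≡ᵇ-false j s (<⇒≢ j<s) = refl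

  bindArgs-lookup : ∀ s {m} ρ (ys : Vec Str m) (j : Fin m) → bindArgs ρ s ys (10 + (s + toℕ j)) ≡ lookup ys j
  bindArgs-lookup s ρ (y ∷ ys) zero
    rewrite +-identityʳ s | bindArgs-below (suc s) (ρ [ 10 + s ↦ y ]) ys s ≤-refl | ≡ᵇ-refl s = refl
  bindArgs-lookup s ρ (y ∷ ys) (suc j) rewrite +-suc s (toℕ j) = bindArgs-lookup (suc s) (ρ [ 10 + s ↦ y ]) ys j

-- Decision-tree leaves: a constant prefix followed by the accumulator, its tail, or nothing.

bitsVec : ∀ n → Str → Vec Bool n
bitsVec zero    s       = []
bitsVec (suc n) []      = false ∷ bitsVec n []
bitsVec (suc n) (b ∷ s) = b ∷ bitsVec n s

data Tail : Set where
  acc dacc none : Tail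

Leaf : Set
Leaf = Str × Tail

tailS : Tail → Str → Str
tailS acc  a = a
tailS dacc a = sem-d a
tailS none a = []

leafS : Leaf → Str → Str
leafS (bs , k) a = bs ++ tailS k a

firstBit : Str → Bool
firstBit []      = false
firstBit (b ∷ _) = b

bitsVec-suc : ∀ n s → bitsVec (suc n) s ≡ firstBit s ∷ bitsVec n (sem-d s)
bitsVec-suc n []      = refl
bitsVec-suc n (_ ∷ _) = refl

sem-If-t₁ : ∀ s (f : Bool → Str) → sem-If (sem-t 𝟏 s) (f true) (f false) ≡ f (firstBit s)
sem-If-t₁ []          f = refl
sem-If-t₁ (true ∷ _)  f = refl
sem-If-t₁ (false ∷ _) f = refl

-- Variable 0 holds the accumulator, variable 1 a read-only
-- "view" string; the other variables below 10 are local binders.  A list of factors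
-- describes a nest of loops, running |xᵢ| + 1 times for  arg i  (a prn over xᵢ) and E times
-- for  num E  (unrolled), so  count  is the product of the weights.  Iteration p of a loop
-- body sees the view with its first B·p bits dropped.

module Loops (ℓ B : ℕ) where

  data Factor : Set where
    arg : Fin ℓ → Factor
    num : ℕ → Factor

  open Arguments ℓ public

  weight : Factor → Lengths → ℕ
  weight (arg i) lz = suc (lz i)
  weight (num E) lz = E

  count : List Factor → Lengths → ℕ
  count []       lz = 1
  count (F ∷ Fs) lz = weight F lz * count Fs lz

  BodyCtx : Ctx → Set
  BodyCtx Γ = ArgsNorm Γ × (Γ 0 ≡ just safe) × (Γ 1 ≡ just safe)

  mutual
    skipE : List Factor → Exp → Exp
    skipE []           x = dropE B x
    skipE (arg i ∷ Fs) x =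
      letE 4 x (app (prn (lam 7 (lam 8 (If var 7 then skipE Fs (var 8) else skipE Fs (var 4))))) (var (argVar i)))
    skipE (num E ∷ Fs) x = skipTimesE E Fs x

    skipTimesE : ℕ → List Factor → Exp → Exp
    skipTimesE zero    Fs x = x
    skipTimesE (suc E) Fs x = skipE Fs (skipTimesE E Fs x)

  mutual
    ⊢skipE : ∀ Fs {Γ x} → ArgsNorm Γ → Γ ⊢ x ∶ ` safe → Γ ⊢ skipE Fs x ∶ ` safe
    ⊢skipE []           g↓ D = ⊢dropE B D
    ⊢skipE (arg i ∷ Fs) g↓ D = ⊢letE D (ty-app isUnion-self (ty-prn (ty-lam (ty-lam
      (⊢If (norm⇒safe (ty-var refl)) (⊢skipE Fs g↓ (ty-var refl)) (⊢skipE Fs g↓ (ty-var refl)))))) (ty-var (g↓ i)))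
    ⊢skipE (num E ∷ Fs) g↓ D = ⊢skipTimesE E Fs g↓ D

    ⊢skipTimesE : ∀ E Fs {Γ x} → ArgsNorm Γ → Γ ⊢ x ∶ ` safe → Γ ⊢ skipTimesE E Fs x ∶ ` safe
    ⊢skipTimesE zero    Fs g↓ D = D
    ⊢skipTimesE (suc E) Fs g↓ D = ⊢skipE Fs g↓ (⊢skipTimesE E Fs g↓ D)

  mutual
    eval-skipE : ∀ Fs {Γ x} (g↓ : ArgsNorm Γ) (D : Γ ⊢ x ∶ ` safe) ρ →
      eval (⊢skipE Fs g↓ D) ρ ≡ drop (B * count Fs (lengths ρ)) (eval D ρ)
    eval-skipE [] g↓ D ρ = trans (eval-dropE B D ρ) (cong (λ k → drop k (eval D ρ)) (sym (*-identityʳ B)))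
    eval-skipE (arg i ∷ Fs) g↓ D ρ = begin
      sem-prn _ x                           ≡⟨ sem-prn-loop _ (λ _ → drop (B * T)) X unfold x ⟩
      loop (suc (length x)) (λ _ → drop (B * T)) X ≡⟨ loop-drop (suc (length x)) (B * T) X ⟩
      drop (suc (length x) * (B * T)) X     ≡⟨ cong (λ k → drop k X) (*-left-comm (suc (length x)) B T) ⟩
      drop (B * (suc (length x) * T)) X     ∎
      where
      open ≡-Reasoning
      x = ρ (argVar i)
      T = count Fs (lengths ρ)
      X = eval D ρ
      unfold : ∀ v w → _ ≡ drop (B * T) (sem-If v w X)
      unfold []      w = eval-skipE Fs g↓ (ty-var refl) (((ρ [ 4 ↦ X ]) [ 7 ↦ [] ]) [ 8 ↦ w ])
      unfold (a ∷ v) w = eval-skipE Fs g↓ (ty-var refl) (((ρ [ 4 ↦ X ]) [ 7 ↦ a ∷ v ]) [ 8 ↦ w ])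
    eval-skipE (num E ∷ Fs) g↓ D ρ =
      trans (eval-skipTimesE E Fs g↓ D ρ) (cong (λ k → drop k (eval D ρ)) (*-left-comm E B (count Fs (lengths ρ))))

    eval-skipTimesE : ∀ E Fs {Γ x} (g↓ : ArgsNorm Γ) (D : Γ ⊢ x ∶ ` safe) ρ →
      eval (⊢skipTimesE E Fs g↓ D) ρ ≡ drop (E * (B * count Fs (lengths ρ))) (eval D ρ)
    eval-skipTimesE zero    Fs g↓ D ρ = refl
    eval-skipTimesE (suc E) Fs g↓ D ρ = begin
      eval (⊢skipE Fs g↓ (⊢skipTimesE E Fs g↓ D)) ρ ≡⟨ eval-skipE Fs g↓ (⊢skipTimesE E Fs g↓ D) ρ ⟩
      drop K (eval (⊢skipTimesE E Fs g↓ D) ρ)      ≡⟨ cong (drop K) (eval-skipTimesE E Fs g↓ D ρ) ⟩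
      drop K (drop (E * K) (eval D ρ))            ≡⟨ drop-drop (E * K) K (eval D ρ) ⟩
      drop (E * K + K) (eval D ρ)                 ≡⟨ cong (λ k → drop k (eval D ρ)) (+-comm (E * K) K) ⟩
      drop (K + E * K) (eval D ρ)                 ∎
      where
      open ≡-Reasoning
      K = B * count Fs (lengths ρ)

  -- With variable 2 bound to a string v, this computes the view advanced by |v| full rounds of  Fs.
  advanceViewE : List Factor → Exp
  advanceViewE Fs = app (prn (lam 5 (lam 6 (If var 5 then skipE Fs (var 6) else var 1)))) (var 2)

  ⊢advanceViewE : ∀ Fs {Γ} → ArgsNorm Γ → Γ 2 ≡ just norm → Γ 1 ≡ just safe → Γ ⊢ advanceViewE Fs ∶ ` safe
  ⊢advanceViewE Fs g↓ Γ2 Γ1 = ty-app isUnion-self (ty-prn (ty-lam (ty-lam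
    (⊢If (norm⇒safe (ty-var refl)) (⊢skipE Fs g↓ (ty-var refl)) (ty-var Γ1))))) (ty-var Γ2)

  dropAfterFirst : ℕ → ℕ → Str → Str
  dropAfterFirst k zero    a = a
  dropAfterFirst k (suc _) a = drop k a

  loop-dropAfterFirst : ∀ k m s → loop (suc m) (dropAfterFirst k) s ≡ drop (m * k) s
  loop-dropAfterFirst k zero    s = refl
  loop-dropAfterFirst k (suc m) s = begin
    drop k (loop (suc m) (dropAfterFirst k) s) ≡⟨ cong (drop k) (loop-dropAfterFirst k m s) ⟩
    drop k (drop (m * k) s)                    ≡⟨ drop-drop (m * k) k s ⟩
    drop (m * k + k) s                         ≡⟨ cong (λ j → drop j s) (+-comm (m * k) k) ⟩
    drop (k + m * k) s                         ∎
    where open ≡-Reasoning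

  eval-advanceViewE : ∀ Fs {Γ} (g↓ : ArgsNorm Γ) Γ2 Γ1 ρ →
    eval (⊢advanceViewE Fs {Γ} g↓ Γ2 Γ1) ρ ≡ drop (length (ρ 2) * (B * count Fs (lengths ρ))) (ρ 1)
  eval-advanceViewE Fs g↓ Γ2 Γ1 ρ =
    trans (sem-prn-loop _ (dropAfterFirst K) (ρ 1) unfold (ρ 2)) (loop-dropAfterFirst K (length (ρ 2)) (ρ 1))
    where
    K = B * count Fs (lengths ρ)
    unfold : ∀ v w → _ ≡ dropAfterFirst K (length v) (sem-If v w (ρ 1))
    unfold []      w = refl
    unfold (a ∷ v) w = eval-skipE Fs g↓ (ty-var refl) ((ρ [ 5 ↦ a ∷ v ]) [ 6 ↦ w ])

  -- In the  arg i  case the prn step falls back on the initial accumulator when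
  -- its argument is ε (the recursive value is then ε as well).
  mutual
    loopE : List Factor → Exp → Exp
    loopE []           b = b
    loopE (arg i ∷ Fs) b = app (prn (lam 2 (lam 3
      (letE 0 (If var 2 then var 3 else var 0) (letE 1 (advanceViewE Fs) (loopE Fs b)))))) (var (argVar i))
    loopE (num E ∷ Fs) b = loopTimesE E Fs b

    loopTimesE : ℕ → List Factor → Exp → Exp
    loopTimesE zero    Fs b = var 0
    loopTimesE (suc E) Fs b = letE 0 (loopTimesE E Fs b) (letE 1 (skipTimesE E Fs (var 1)) (loopE Fs b))

  ⊢Body : Exp → Set
  ⊢Body b = ∀ {Γ} → BodyCtx Γ → Γ ⊢ b ∶ ` safe

  mutual
    ⊢loopE : ∀ Fs {b} → ⊢Body b → ⊢Body (loopE Fs b)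
    ⊢loopE []           ⊢b g = ⊢b g
    ⊢loopE (arg i ∷ Fs) ⊢b (g↓ , Γ0 , Γ1) = ty-app isUnion-self (ty-prn (ty-lam (ty-lam
      (⊢letE (⊢If (norm⇒safe (ty-var refl)) (ty-var refl) (ty-var Γ0))
        (⊢letE (⊢advanceViewE Fs g↓ refl Γ1) (⊢loopE Fs ⊢b (g↓ , refl , refl))))))) (ty-var (g↓ i))
    ⊢loopE (num E ∷ Fs) ⊢b g = ⊢loopTimesE E Fs ⊢b g

    ⊢loopTimesE : ∀ E Fs {b} → ⊢Body b → ⊢Body (loopTimesE E Fs b)
    ⊢loopTimesE zero    Fs ⊢b (g↓ , Γ0 , Γ1) = ty-var Γ0
    ⊢loopTimesE (suc E) Fs ⊢b (g↓ , Γ0 , Γ1) = ⊢letE (⊢loopTimesE E Fs ⊢b (g↓ , Γ0 , Γ1))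
      (⊢letE (⊢skipTimesE E Fs g↓ (ty-var Γ1)) (⊢loopE Fs ⊢b (g↓ , refl , refl)))

  BodyDenotes : ∀ {b} → ⊢Body b → (Lengths → Str → Str → Str) → Set
  BodyDenotes ⊢b body = ∀ {Γ} (g : BodyCtx Γ) ρ → eval (⊢b {Γ} g) ρ ≡ body (lengths ρ) (ρ 1) (ρ 0)

  drop-rounds : ∀ j T p (v : Str) → drop (B * p) (drop (j * (B * T)) v) ≡ drop (B * (j * T + p)) v
  drop-rounds j T p v = begin
    drop (B * p) (drop (j * (B * T)) v) ≡⟨ drop-drop (j * (B * T)) (B * p) v ⟩
    drop (j * (B * T) + B * p) v        ≡⟨ cong (λ k → drop (k + B * p) v) (*-left-comm j B T) ⟩
    drop (B * (j * T) + B * p) v        ≡⟨ cong (λ k → drop k v) (sym (*-distribˡ-+ B (j * T) p)) ⟩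
    drop (B * (j * T + p)) v            ∎
    where open ≡-Reasoning

  mutual
    eval-loopE : ∀ Fs {b} (⊢b : ⊢Body b) body → BodyDenotes ⊢b body → ∀ {Γ} (g : BodyCtx Γ) ρ →
      eval (⊢loopE Fs ⊢b {Γ} g) ρ
        ≡ loop (count Fs (lengths ρ)) (λ p → body (lengths ρ) (drop (B * p) (ρ 1))) (ρ 0)
    eval-loopE [] ⊢b body ok g ρ =
      trans (ok g ρ) (cong (λ k → body (lengths ρ) (drop k (ρ 1)) (ρ 0)) (sym (*-zeroʳ B)))
    eval-loopE (arg i ∷ Fs) ⊢b body ok {Γ} (g↓ , Γ0 , Γ1) ρ = begin
      sem-prn _ x                   ≡⟨ sem-prn-loop _ round (ρ 0) unfold x ⟩
      loop (suc (length x)) round (ρ 0)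
        ≡⟨ loop-cong (suc (length x)) refl (λ j a _ →
             loop-cong T (refl {x = a}) (λ p a′ _ → cong (λ v → body lz v a′) (drop-rounds j T p (ρ 1)))) ⟩
      loop (suc (length x)) (λ j → loop T (λ p → G (j * T + p))) (ρ 0)
        ≡⟨ loop-* (suc (length x)) T G (ρ 0) ⟨
      loop (suc (length x) * T) G (ρ 0) ∎
      where
      open ≡-Reasoning
      x = ρ (argVar i)
      lz = lengths ρ
      T = count Fs lz
      G : ℕ → Str → Str
      G p = body lz (drop (B * p) (ρ 1))
      round : ℕ → Str → Str
      round j = loop T (λ p → body lz (drop (B * p) (drop (j * (B * T)) (ρ 1))))
      unfold : ∀ v w → _ ≡ round (length v) (sem-If v w (ρ 0))
      unfold v w = trans (eval-loopE Fs ⊢b body ok {Γ′ ,, 1 ∶ safe} (g↓ , refl , refl) ρ″)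
        (loop-cong T refl (λ p a _ →
          cong (λ u → body lz (drop (B * p) u) a) (eval-advanceViewE Fs {Γ′} g↓ refl Γ1 ρ′)))
        where
        Γ′ = ((Γ ,, 2 ∶ norm) ,, 3 ∶ safe) ,, 0 ∶ safe
        ρ′ = ((ρ [ 2 ↦ v ]) [ 3 ↦ w ]) [ 0 ↦ sem-If v w (ρ 0) ]
        ρ″ = ρ′ [ 1 ↦ eval (⊢advanceViewE Fs {Γ′} g↓ refl Γ1) ρ′ ]
    eval-loopE (num E ∷ Fs) ⊢b body ok g ρ = eval-loopTimesE E Fs ⊢b body ok g ρ

    eval-loopTimesE : ∀ E Fs {b} (⊢b : ⊢Body b) body → BodyDenotes ⊢b body → ∀ {Γ} (g : BodyCtx Γ) ρ →
      eval (⊢loopTimesE E Fs ⊢b {Γ} g) ρ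
        ≡ loop (E * count Fs (lengths ρ)) (λ p → body (lengths ρ) (drop (B * p) (ρ 1))) (ρ 0)
    eval-loopTimesE zero    Fs ⊢b body ok g ρ = refl
    eval-loopTimesE (suc E) Fs ⊢b body ok {Γ} (g↓ , Γ0 , Γ1) ρ = begin
      eval (⊢loopE Fs ⊢b (g↓ , refl , refl)) ρ″
        ≡⟨ eval-loopE Fs ⊢b body ok {(Γ ,, 0 ∶ safe) ,, 1 ∶ safe} (g↓ , refl , refl) ρ″ ⟩
      loop T (λ p → body lz (drop (B * p) (ρ″ 1))) (ρ′ 0)
        ≡⟨ loop-cong T (eval-loopTimesE E Fs ⊢b body ok (g↓ , Γ0 , Γ1) ρ) (λ p a _ →
             cong (λ u → body lz u a) (trans (cong (drop (B * p)) (eval-skipTimesE E Fs g↓ (ty-var Γ1) ρ′))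
                                             (drop-rounds E T p (ρ 1)))) ⟩
      loop T (λ p → G (E * T + p)) (loop (E * T) G (ρ 0))
        ≡⟨ loop-+ (E * T) T G (ρ 0) ⟨
      loop (E * T + T) G (ρ 0)
        ≡⟨ cong (λ k → loop k G (ρ 0)) (+-comm (E * T) T) ⟩
      loop (T + E * T) G (ρ 0) ∎
      where
      open ≡-Reasoning
      lz = lengths ρ
      T = count Fs lz
      G : ℕ → Str → Str
      G p = body lz (drop (B * p) (ρ 1))
      ρ′ = ρ [ 0 ↦ eval (⊢loopTimesE E Fs ⊢b {Γ} (g↓ , Γ0 , Γ1)) ρ ]
      ρ″ = ρ′ [ 1 ↦ eval (⊢skipTimesE E Fs {Γ ,, 0 ∶ safe} g↓ (ty-var Γ1)) ρ′ ]

  tailE : Tail → Exp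
  tailE acc  = var 0
  tailE dacc = d (var 0)
  tailE none = const []

  ⊢tailE : ∀ k → ⊢Body (tailE k)
  ⊢tailE acc  (g , Γ0 , Γ1) = ty-var Γ0
  ⊢tailE dacc (g , Γ0 , Γ1) = ty-d (ty-var Γ0)
  ⊢tailE none g             = ty-const

  eval-tailE : ∀ k {Γ} (g : BodyCtx Γ) ρ → eval (⊢tailE k {Γ} g) ρ ≡ tailS k (ρ 0)
  eval-tailE acc  g ρ = refl
  eval-tailE dacc g ρ = refl
  eval-tailE none g ρ = refl

  leafE : Leaf → Exp
  leafE (bs , k) = prefixE bs (tailE k)

  ⊢leafE : ∀ lf → ⊢Body (leafE lf)
  ⊢leafE (bs , k) g = ⊢prefixE bs (⊢tailE k g)

  eval-leafE : ∀ lf {Γ} (g : BodyCtx Γ) ρ → eval (⊢leafE lf {Γ} g) ρ ≡ leafS lf (ρ 0)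
  eval-leafE (bs , k) g ρ = trans (eval-prefixE bs (⊢tailE k g) ρ) (cong (bs ++_) (eval-tailE k g ρ))

  -- Branches on the n view bits from position  off  on (a missing bit reads as 𝟎).
  decideE : ∀ n → ℕ → (Vec Bool n → Leaf) → Exp
  decideE zero    off lf = leafE (lf [])
  decideE (suc n) off lf =
    If t₁ (dropE off (var 1)) then decideE n (suc off) (lf ∘ (true ∷_)) else decideE n (suc off) (lf ∘ (false ∷_))

  ⊢decideE : ∀ n off lf → ⊢Body (decideE n off lf)
  ⊢decideE zero    off lf g = ⊢leafE (lf []) g
  ⊢decideE (suc n) off lf g@(_ , _ , Γ1) =
    ⊢If (ty-t₁ (⊢dropE off (ty-var Γ1))) (⊢decideE n (suc off) _ g) (⊢decideE n (suc off) _ g)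

  eval-decideE : ∀ n off lf {Γ} (g : BodyCtx Γ) ρ →
    eval (⊢decideE n off lf {Γ} g) ρ ≡ leafS (lf (bitsVec n (drop off (ρ 1)))) (ρ 0)
  eval-decideE zero    off lf g ρ = eval-leafE (lf []) g ρ
  eval-decideE (suc n) off lf g@(_ , _ , Γ1) ρ = begin
    eval (⊢decideE (suc n) off lf g) ρ
      ≡⟨ cong₃ sem-If (cong (sem-t 𝟏) (eval-dropE off (ty-var Γ1) ρ))
                      (eval-decideE n (suc off) _ g ρ) (eval-decideE n (suc off) _ g ρ) ⟩
    sem-If (sem-t 𝟏 s) (leafAt true) (leafAt false)
      ≡⟨ sem-If-t₁ s leafAt ⟩
    leafAt (firstBit s)
      ≡⟨ cong (λ w → leafS (lf (firstBit s ∷ bitsVec n w)) (ρ 0)) (sem-d∘drop off (ρ 1)) ⟨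
    leafS (lf (firstBit s ∷ bitsVec n (sem-d s))) (ρ 0)
      ≡⟨ cong (λ v → leafS (lf v) (ρ 0)) (bitsVec-suc n s) ⟨
    leafS (lf (bitsVec (suc n) s)) (ρ 0) ∎
    where
    open ≡-Reasoning
    s = drop off (ρ 1)
    leafAt : Bool → Str
    leafAt b = leafS (lf (b ∷ bitsVec n (drop (suc off) (ρ 1)))) (ρ 0)

  count-++ : ∀ Fs Gs lz → count (Fs ++ Gs) lz ≡ count Fs lz * count Gs lz
  count-++ []       Gs lz = sym (*-identityˡ (count Gs lz))
  count-++ (F ∷ Fs) Gs lz =
    trans (cong (weight F lz *_) (count-++ Fs Gs lz)) (sym (*-assoc (weight F lz) (count Fs lz) (count Gs lz)))

  argFactors : ∀ m → (Fin m → Fin ℓ) → List Factor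
  argFactors zero    arg# = []
  argFactors (suc m) arg# = arg (arg# zero) ∷ argFactors m (arg# ∘ suc)

  allArgs : List Factor
  allArgs = argFactors ℓ (λ i → i)

  allArgs^ : ℕ → List Factor
  allArgs^ zero    = []
  allArgs^ (suc k) = allArgs ++ allArgs^ k

  count-allArgs^ : ∀ k lz → count (allArgs^ k) lz ≡ count allArgs lz ^ k
  count-allArgs^ zero    lz = refl
  count-allArgs^ (suc k) lz = trans (count-++ allArgs (allArgs^ k) lz) (cong (count allArgs lz *_) (count-allArgs^ k lz))

  totalLength<count : ∀ m arg# lz (xs : Vec Str m) → (∀ j → lz (arg# j) ≡ length (lookup xs j)) →
    suc (totalLength xs) ≤ count (argFactors m arg#) lz
  totalLength<count zero    arg# lz []       lz≡ = ≤-refl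
  totalLength<count (suc m) arg# lz (x ∷ xs) lz≡ = begin
    suc (length x + totalLength xs)          ≡⟨ cong suc (+-comm (length x) (totalLength xs)) ⟩
    suc (totalLength xs) + length x          ≤⟨ +-mono-≤ IH (≤-trans (≤-reflexive (sym (*-identityʳ (length x))))
                                                                    (*-monoʳ-≤ (length x) (≤-trans (s≤s z≤n) IH))) ⟩
    C + length x * C                         ≡⟨ cong (λ l → C + l * C) (lz≡ zero) ⟨
    suc (lz (arg# zero)) * C                 ∎
    where
    open ≤-Reasoning
    C = count (argFactors m (arg# ∘ suc)) lz
    IH = totalLength<count m (arg# ∘ suc) lz xs (lz≡ ∘ suc)

-- Fixed-width bit codes

zeros : ∀ n → Vec Bool n
zeros n = replicate n false

unary : ∀ {n} → Fin (suc n) → Vec Bool n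
unary {n}     zero    = zeros n
unary {suc n} (suc i) = true ∷ unary i

fromUnary : ∀ {n} → Vec Bool n → Fin (suc n)
fromUnary []          = zero
fromUnary (false ∷ v) = zero
fromUnary (true ∷ v)  = suc (fromUnary v)

fromUnary-zeros : ∀ n → fromUnary (zeros n) ≡ zero
fromUnary-zeros zero    = refl
fromUnary-zeros (suc n) = refl

fromUnary-unary : ∀ {n} (i : Fin (suc n)) → fromUnary (unary i) ≡ i
fromUnary-unary {n}     zero    = fromUnary-zeros n
fromUnary-unary {suc n} (suc i) = cong suc (fromUnary-unary i)

splitVec : ∀ m {k} → Vec Bool (m + k) → Vec Bool m × Vec Bool k
splitVec zero    v       = [] , v
splitVec (suc m) (b ∷ v) with splitVec m v
... | x , y = b ∷ x , y

splitVec-++ : ∀ {m k} (u : Vec Bool m) (v : Vec Bool k) → splitVec m (u Vec.++ v) ≡ (u , v)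
splitVec-++ []      v = refl
splitVec-++ (b ∷ u) v rewrite splitVec-++ u v = refl

splitVec-zeros : ∀ m k → splitVec m (zeros (m + k)) ≡ (zeros m , zeros k)
splitVec-zeros zero    k = refl
splitVec-zeros (suc m) k rewrite splitVec-zeros m k = refl

bitsVec-toList : ∀ {m} (v : Vec Bool m) w → bitsVec m (toList v ++ w) ≡ v
bitsVec-toList []      w = refl
bitsVec-toList (b ∷ v) w = cong (b ∷_) (bitsVec-toList v w)

bitsVec-[] : ∀ n → bitsVec n [] ≡ zeros n
bitsVec-[] zero    = refl
bitsVec-[] (suc n) = cong (false ∷_) (bitsVec-[] n)

splitVec-bitsVec : ∀ m k w → splitVec m (bitsVec (m + k) w) ≡ (bitsVec m w , bitsVec k (drop m w))
splitVec-bitsVec zero    k w       = refl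
splitVec-bitsVec (suc m) k []      rewrite splitVec-bitsVec m k [] | drop-[] {A = Bit} m = refl
splitVec-bitsVec (suc m) k (b ∷ w) rewrite splitVec-bitsVec m k w = refl

bitsVec-toList-++ : ∀ {m} (u : Vec Bool m) k w → bitsVec (m + k) (toList u ++ w) ≡ u Vec.++ bitsVec k w
bitsVec-toList-++ []      k w = refl
bitsVec-toList-++ (b ∷ u) k w = cong (b ∷_) (bitsVec-toList-++ u k w)

drop-toList-++ : ∀ {m} (v : Vec Bool m) w → drop m (toList v ++ w) ≡ w
drop-toList-++ []      w = refl
drop-toList-++ (b ∷ v) w = drop-toList-++ v w

drop-+-toList-++ : ∀ {m} (v : Vec Bool m) k w → drop (m + k) (toList v ++ w) ≡ drop k w
drop-+-toList-++ {m} v k w = trans (sym (drop-drop m k (toList v ++ w))) (cong (drop k) (drop-toList-++ v w))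

-- Strings of cells: a cell carries a symbol in Fin (suc k) and possibly the
-- head state, coded in Q + k bits as unary (head state) ++ unary (symbol),
-- where a missing head is state code 0.  Reading past the end gives a blank cell.

module CellCode (Q k : ℕ) where

  Cell : Set
  Cell = Fin (suc k) × Maybe (Fin Q)

  blankCell : Cell
  blankCell = zero , nothing

  toMaybe : Fin (suc Q) → Maybe (Fin Q)
  toMaybe zero    = nothing
  toMaybe (suc q) = just q

  fromMaybe : Maybe (Fin Q) → Fin (suc Q)
  fromMaybe nothing  = zero
  fromMaybe (just q) = suc q

  toMaybe-fromMaybe : ∀ m → toMaybe (fromMaybe m) ≡ m
  toMaybe-fromMaybe nothing  = refl
  toMaybe-fromMaybe (just q) = refl

  width : ℕ
  width = Q + k

  cellBits : Cell → Vec Bool width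
  cellBits (s , m) = unary (fromMaybe m) Vec.++ unary s

  decodeCell : Vec Bool width → Cell
  decodeCell v with splitVec Q v
  ... | x , y = fromUnary y , toMaybe (fromUnary x)

  decodeCell-cellBits : ∀ c → decodeCell (cellBits c) ≡ c
  decodeCell-cellBits (s , m)
    rewrite splitVec-++ (unary (fromMaybe m)) (unary s) | fromUnary-unary s
          | fromUnary-unary (fromMaybe m) | toMaybe-fromMaybe m = refl

  decodeCell-zeros : decodeCell (zeros width) ≡ blankCell
  decodeCell-zeros rewrite splitVec-zeros Q k | fromUnary-zeros Q | fromUnary-zeros k = refl

  encodeCell : Cell → Str
  encodeCell c = toList (cellBits c)

  cellAt : Str → ℕ → Cell
  cellAt str i = decodeCell (bitsVec width (drop (width * i) str))

  cellAt-head : ∀ c rest → cellAt (encodeCell c ++ rest) 0 ≡ c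
  cellAt-head c rest rewrite *-zeroʳ width | bitsVec-toList (cellBits c) rest = decodeCell-cellBits c

  cellAt-suc : ∀ c rest i → cellAt (encodeCell c ++ rest) (suc i) ≡ cellAt rest i
  cellAt-suc c rest i rewrite *-suc width i | drop-+-toList-++ (cellBits c) (width * i) rest = refl

  cellAt-[] : ∀ i → cellAt [] i ≡ blankCell
  cellAt-[] i rewrite drop-[] {A = Bit} (width * i) | bitsVec-[] width = decodeCell-zeros

  writeCells : ℕ → (ℕ → Cell) → Str
  writeCells n h = loop n (λ p a → encodeCell (h p) ++ a) []

  cellAt-writeCells : ∀ n h i → i < n → cellAt (writeCells n h) i ≡ h (n ∸ suc i)
  cellAt-writeCells (suc n) h zero    _         = cellAt-head (h n) (writeCells n h)
  cellAt-writeCells (suc n) h (suc i) (s≤s i<n) =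
    trans (cellAt-suc (h n) (writeCells n h) i) (cellAt-writeCells n h i i<n)

  cellAt-writeCells-beyond : ∀ n h i → n ≤ i → cellAt (writeCells n h) i ≡ blankCell
  cellAt-writeCells-beyond zero    h i       _         = cellAt-[] i
  cellAt-writeCells-beyond (suc n) h (suc i) (s≤s n≤i) =
    trans (cellAt-suc (h n) (writeCells n h) i) (cellAt-writeCells-beyond n h i n≤i)

  cellBefore : Str → ℕ → Cell
  cellBefore C zero    = blankCell
  cellBefore C (suc j) = cellAt C j

  Rule : Set
  Rule = Cell → Cell → Cell → Cell

  centre : Rule
  centre l c r = c

  neighbourhood : Rule → Str → ℕ → Cell
  neighbourhood g C′ p = g (cellAt C′ p) (cellAt C′ (suc p)) (cellAt C′ (suc (suc p)))

  rebuild : ℕ → Rule → Str → Str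
  rebuild W g C = writeCells W (neighbourhood g (encodeCell blankCell ++ C))

  -- rebuild lists the new cells in reverse order; a second pass with  centre  restores it.
  applyRule : ℕ → Rule → Str → Str
  applyRule W g C = rebuild W centre (rebuild W g C)

  cellAt-padded : ∀ C p → cellAt (encodeCell blankCell ++ C) p ≡ cellBefore C p
  cellAt-padded C zero    = cellAt-head blankCell C
  cellAt-padded C (suc p) = cellAt-suc blankCell C p

  cellAt-applyRule : ∀ W g C i → i < W → cellAt (applyRule W g C) i ≡ g (cellBefore C i) (cellAt C i) (cellAt C (suc i))
  cellAt-applyRule (suc W) g C i (s≤s i≤W) = begin
    cellAt (applyRule (suc W) g C) i
      ≡⟨ cellAt-writeCells (suc W) (neighbourhood centre (encodeCell blankCell ++ rebuild (suc W) g C)) i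
                           (s≤s i≤W) ⟩
    cellAt (encodeCell blankCell ++ rebuild (suc W) g C) (suc (W ∸ i))
      ≡⟨ cellAt-suc blankCell (rebuild (suc W) g C) (W ∸ i) ⟩
    cellAt (rebuild (suc W) g C) (W ∸ i)
      ≡⟨ cellAt-writeCells (suc W) (neighbourhood g C′) (W ∸ i) (s≤s (m∸n≤m W i)) ⟩
    neighbourhood g C′ (W ∸ (W ∸ i))
      ≡⟨ cong (neighbourhood g C′) (m∸[m∸n]≡n i≤W) ⟩
    g (cellAt C′ i) (cellAt C′ (suc i)) (cellAt C′ (suc (suc i)))
      ≡⟨ cong₃ g (cellAt-padded C i) (cellAt-suc blankCell C i) (cellAt-suc blankCell C (suc i)) ⟩
    g (cellBefore C i) (cellAt C i) (cellAt C (suc i)) ∎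
    where
    open ≡-Reasoning
    C′ = encodeCell blankCell ++ C

  cellAt-applyRule-beyond : ∀ W g C i → W ≤ i → cellAt (applyRule W g C) i ≡ blankCell
  cellAt-applyRule-beyond W g C i =
    cellAt-writeCells-beyond W (neighbourhood centre (encodeCell blankCell ++ rebuild W g C)) i

-- A Turing machine as a cellular automaton on cell strings

module Simulation (M : TM) where
  open TM M
  open CellCode Q (3 + extra) public

  Action : Set
  Action = Maybe (Fin Q × Sym M × Move)

  rightwardState : Action → Maybe (Fin Q)
  rightwardState (just (q′ , _ , R)) = just q′
  rightwardState _                   = nothing

  leftwardState : Action → Maybe (Fin Q)
  leftwardState (just (q′ , _ , L)) = just q′
  leftwardState _                   = nothing

  stayingState : Move → Fin Q → Maybe (Fin Q)
  stayingState S q = just q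
  stayingState L q = nothing
  stayingState R q = nothing

  headCellAfter : Action → Sym M → Fin Q → Cell
  headCellAfter nothing             s q = s , just q
  headCellAfter (just (q′ , w , m)) s q = w , stayingState m q′

  enteringFromLeft : Cell → Maybe (Fin Q)
  enteringFromLeft (s , nothing) = nothing
  enteringFromLeft (s , just q)  = rightwardState (δ q s)

  enteringFromRight : Cell → Maybe (Fin Q)
  enteringFromRight (s , nothing) = nothing
  enteringFromRight (s , just q)  = leftwardState (δ q s)

  caRule : Rule
  caRule l (s , just q)  r = headCellAfter (δ q s) s q
  caRule l (s , nothing) r with enteringFromLeft l
  ... | just q  = s , just q
  ... | nothing = s , enteringFromRight r

  headAt : ℕ → Fin Q → ℕ → Maybe (Fin Q)
  headAt P q i = if i ≡ᵇ P then just q else nothing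

  cellsOf : (ℕ → Sym M) → ℕ → Fin Q → ℕ → Cell
  cellsOf f P q i = f i , headAt P q i

  cellsBefore : (ℕ → Sym M) → ℕ → Fin Q → ℕ → Cell
  cellsBefore f P q zero    = blankCell
  cellsBefore f P q (suc j) = cellsOf f P q j

  write : (ℕ → Sym M) → ℕ → Sym M → ℕ → Sym M
  write f P w i = if i ≡ᵇ P then w else f i

  movePos : Move → ℕ → ℕ
  movePos S P = P
  movePos L P = pred P
  movePos R P = suc P

  cellsAfter : Action → (ℕ → Sym M) → ℕ → Fin Q → ℕ → Cell
  cellsAfter nothing             f P q = cellsOf f P q
  cellsAfter (just (q′ , w , m)) f P q = cellsOf (write f P w) (movePos m P) q′

  caStep : (ℕ → Sym M) → ℕ → Fin Q → ℕ → Cell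
  caStep f P q i = caRule (cellsBefore f P q i) (cellsOf f P q i) (cellsOf f P q (suc i))

  caStep-atHead : ∀ f p q → caStep f (suc p) q (suc p) ≡ cellsAfter (δ q (f (suc p))) f (suc p) q (suc p)
  caStep-atHead f p q rewrite ≡ᵇ-refl p with δ q (f (suc p))
  ... | nothing           rewrite ≡ᵇ-refl p = refl
  ... | just (q′ , w , S) rewrite ≡ᵇ-refl p = refl
  ... | just (q′ , w , L) rewrite ≡ᵇ-refl p | ≢⇒≡ᵇ-false (suc p) p 1+n≢n = refl
  ... | just (q′ , w , R) rewrite ≡ᵇ-refl p | ≢⇒≡ᵇ-false p (suc p) (1+n≢n ∘ sym) = refl

  caStep-rightOfHead : ∀ f p q →
    caStep f (suc p) q (suc (suc p)) ≡ cellsAfter (δ q (f (suc p))) f (suc p) q (suc (suc p))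
  caStep-rightOfHead f p q
    rewrite ≡ᵇ-refl p | ≢⇒≡ᵇ-false (suc p) p 1+n≢n | ≢⇒≡ᵇ-false (suc (suc p)) p (2+n≢n p)
    with δ q (f (suc p))
  ... | nothing           rewrite ≢⇒≡ᵇ-false (suc p) p 1+n≢n = refl
  ... | just (q′ , w , S) rewrite ≢⇒≡ᵇ-false (suc p) p 1+n≢n = refl
  ... | just (q′ , w , L) rewrite ≢⇒≡ᵇ-false (suc p) p 1+n≢n | ≢⇒≡ᵇ-false (suc (suc p)) p (2+n≢n p) = refl
  ... | just (q′ , w , R) rewrite ≡ᵇ-refl p | ≢⇒≡ᵇ-false (suc p) p 1+n≢n = refl

  caStep-leftOfHead : ∀ f i q → caStep f (suc i) q i ≡ cellsAfter (δ q (f (suc i))) f (suc i) q i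
  caStep-leftOfHead f zero q with δ q (f 1)
  ... | nothing           = refl
  ... | just (q′ , w , S) = refl
  ... | just (q′ , w , L) = refl
  ... | just (q′ , w , R) = refl
  caStep-leftOfHead f (suc j) q
    rewrite ≢⇒≡ᵇ-false j (suc (suc j)) (2+n≢n j ∘ sym) | ≢⇒≡ᵇ-false j (suc j) (1+n≢n ∘ sym) | ≡ᵇ-refl j
    with δ q (f (suc (suc j)))
  ... | nothing           rewrite ≢⇒≡ᵇ-false j (suc j) (1+n≢n ∘ sym) = refl
  ... | just (q′ , w , S) rewrite ≢⇒≡ᵇ-false j (suc j) (1+n≢n ∘ sym) = refl
  ... | just (q′ , w , L) rewrite ≢⇒≡ᵇ-false j (suc j) (1+n≢n ∘ sym) | ≡ᵇ-refl j = refl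
  ... | just (q′ , w , R)
    rewrite ≢⇒≡ᵇ-false j (suc j) (1+n≢n ∘ sym) | ≢⇒≡ᵇ-false j (suc (suc j)) (2+n≢n j ∘ sym) = refl

  caStep-far : ∀ f p q i → i ≢ suc p → i ≢ suc (suc p) → suc i ≢ suc p →
    caStep f (suc p) q i ≡ cellsAfter (δ q (f (suc p))) f (suc p) q i
  caStep-far f p q zero i≢P i≢P+1 i+1≢P rewrite ≢⇒≡ᵇ-false zero p (i+1≢P ∘ cong suc) with δ q (f (suc p))
  ... | nothing           = refl
  ... | just (q′ , w , S) = refl
  ... | just (q′ , w , L) rewrite ≢⇒≡ᵇ-false zero p (i+1≢P ∘ cong suc) = refl
  ... | just (q′ , w , R) = refl
  caStep-far f p q (suc j) i≢P i≢P+1 i+1≢P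
    rewrite ≢⇒≡ᵇ-false j (suc p) (i≢P+1 ∘ cong suc) | ≢⇒≡ᵇ-false j p (i≢P ∘ cong suc)
          | ≢⇒≡ᵇ-false (suc j) p (i+1≢P ∘ cong suc)
    with δ q (f (suc p))
  ... | nothing           rewrite ≢⇒≡ᵇ-false j p (i≢P ∘ cong suc) = refl
  ... | just (q′ , w , S) rewrite ≢⇒≡ᵇ-false j p (i≢P ∘ cong suc) = refl
  ... | just (q′ , w , L)
    rewrite ≢⇒≡ᵇ-false j p (i≢P ∘ cong suc) | ≢⇒≡ᵇ-false (suc j) p (i+1≢P ∘ cong suc) = refl
  ... | just (q′ , w , R)
    rewrite ≢⇒≡ᵇ-false j p (i≢P ∘ cong suc) | ≢⇒≡ᵇ-false j (suc p) (i≢P+1 ∘ cong suc) = refl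

  -- The head is kept at a positive position, so a left move never leaves the represented tape.
  caStep-correct : ∀ f p q i → caStep f (suc p) q i ≡ cellsAfter (δ q (f (suc p))) f (suc p) q i
  caStep-correct f p q i with i ≟ suc p
  ... | yes refl = caStep-atHead f p q
  ... | no i≢P with i ≟ suc (suc p)
  ... | yes refl = caStep-rightOfHead f p q
  ... | no i≢P+1 with suc i ≟ suc p
  ... | yes refl = caStep-leftOfHead f i q
  ... | no i+1≢P = caStep-far f p q i i≢P i≢P+1 i+1≢P

  symAt : List (Sym M) → ℕ → Sym M
  symAt []       _       = blank M
  symAt (x ∷ xs) zero    = x
  symAt (x ∷ xs) (suc n) = symAt xs n

  behead : List (Sym M) → List (Sym M)
  behead []       = []
  behead (x ∷ xs) = xs

  symAt-behead : ∀ xs n → symAt (behead xs) n ≡ symAt xs (suc n)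
  symAt-behead []       n = refl
  symAt-behead (x ∷ xs) n = refl

  length-behead : ∀ xs → length (behead xs) ≤ length xs
  length-behead []       = z≤n
  length-behead (x ∷ xs) = n≤1+n (length xs)

  symAt-beyond : ∀ xs n → length xs ≤ n → symAt xs n ≡ blank M
  symAt-beyond []       n       _         = refl
  symAt-beyond (x ∷ xs) (suc n) (s≤s l≤n) = symAt-beyond xs n l≤n

  -- The tape of  conf q ls h rs  laid out with the head at position P.
  tapeAt : List (Sym M) → Sym M → List (Sym M) → ℕ → ℕ → Sym M
  tapeAt ls h rs zero    zero    = h
  tapeAt ls h rs zero    (suc i) = symAt rs i
  tapeAt ls h rs (suc P) zero    = symAt ls P
  tapeAt ls h rs (suc P) (suc i) = tapeAt ls h rs P i

  tapeAt-head : ∀ ls h rs P → tapeAt ls h rs P P ≡ h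
  tapeAt-head ls h rs zero    = refl
  tapeAt-head ls h rs (suc P) = tapeAt-head ls h rs P

  tapeAt-fromHead : ∀ ls h rs P j → tapeAt ls h rs P (P + j) ≡ symAt (h ∷ rs) j
  tapeAt-fromHead ls h rs zero    zero    = refl
  tapeAt-fromHead ls h rs zero    (suc j) = refl
  tapeAt-fromHead ls h rs (suc P) j       = tapeAt-fromHead ls h rs P j

  tapeAt-beyond : ∀ ls h rs P i → P + length rs < i → tapeAt ls h rs P i ≡ blank M
  tapeAt-beyond ls h rs zero    (suc i) (s≤s lt) = symAt-beyond rs i lt
  tapeAt-beyond ls h rs (suc P) (suc i) (s≤s lt) = tapeAt-beyond ls h rs P i lt

  tapeAt-writeS : ∀ ls h rs w P i → tapeAt ls w rs P i ≡ write (tapeAt ls h rs P) P w i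
  tapeAt-writeS ls h rs w zero    zero    = refl
  tapeAt-writeS ls h rs w zero    (suc i) = refl
  tapeAt-writeS ls h rs w (suc P) zero    = refl
  tapeAt-writeS ls h rs w (suc P) (suc i) = tapeAt-writeS ls h rs w P i

  tapeAt-writeR : ∀ ls h rs w P i →
    tapeAt (w ∷ ls) (symAt rs 0) (behead rs) (suc P) i ≡ write (tapeAt ls h rs P) P w i
  tapeAt-writeR ls h rs w zero    zero          = refl
  tapeAt-writeR ls h rs w zero    (suc zero)    = refl
  tapeAt-writeR ls h rs w zero    (suc (suc i)) = symAt-behead rs i
  tapeAt-writeR ls h rs w (suc P) zero          = refl
  tapeAt-writeR ls h rs w (suc P) (suc i)       = tapeAt-writeR ls h rs w P i

  tapeAt-writeL : ∀ ls h rs w P i →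
    tapeAt (behead ls) (symAt ls 0) (w ∷ rs) P i ≡ write (tapeAt ls h rs (suc P)) (suc P) w i
  tapeAt-writeL ls h rs w zero    zero          = refl
  tapeAt-writeL ls h rs w zero    (suc zero)    = refl
  tapeAt-writeL ls h rs w zero    (suc (suc i)) = refl
  tapeAt-writeL ls h rs w (suc P) zero          = symAt-behead ls P
  tapeAt-writeL ls h rs w (suc P) (suc i)       = tapeAt-writeL ls h rs w P i

  headAt-beyond : ∀ P q i → P < i → headAt P q i ≡ nothing
  headAt-beyond P q i P<i rewrite ≢⇒≡ᵇ-false i P (<⇒≢ P<i ∘ sym) = refl

  stepWith : Action → Fin Q → List (Sym M) → Sym M → List (Sym M) → Config M
  stepWith nothing             q ls h rs = conf q ls h rs
  stepWith (just (q′ , w , m)) q ls h rs with shift M m ls w rs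
  ... | ls′ , h′ , rs′ = conf q′ ls′ h′ rs′

  step≡stepWith : ∀ q ls h rs → step M (conf q ls h rs) ≡ stepWith (δ q h) q ls h rs
  step≡stepWith q ls h rs with δ q h
  ... | nothing = refl
  ... | just (q′ , w , m) with shift M m ls w rs
  ... | _ = refl

  shift-R : ∀ ls w rs → shift M R ls w rs ≡ (w ∷ ls , symAt rs 0 , behead rs)
  shift-R ls w []       = refl
  shift-R ls w (r ∷ rs) = refl

  shift-L : ∀ ls w rs → shift M L ls w rs ≡ (behead ls , symAt ls 0 , w ∷ rs)
  shift-L []       w rs = refl
  shift-L (l ∷ ls) w rs = refl

  headPosAfter : Action → ℕ → ℕ
  headPosAfter nothing             P = P
  headPosAfter (just (_ , _ , m)) P = movePos m P

  configCells : Config M → ℕ → ℕ → Cell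
  configCells (conf q ls h rs) P = cellsOf (tapeAt ls h rs P) P q

  rightLen : Config M → ℕ
  rightLen (conf _ _ _ rs) = length rs

  configCells-beyond : ∀ c P i → P + rightLen c < i → configCells c P i ≡ blankCell
  configCells-beyond (conf q ls h rs) P i lt =
    cong₂ _,_ (tapeAt-beyond ls h rs P i lt) (headAt-beyond P q i (≤-<-trans (m≤m+n P (length rs)) lt))

  caStep-simulates : ∀ q ls h rs p i → let c = conf q ls h rs in
    caStep (tapeAt ls h rs (suc p)) (suc p) q i ≡ configCells (step M c) (headPosAfter (δ q h) (suc p)) i
  caStep-simulates q ls h rs p i = begin
    caStep f (suc p) q i                                  ≡⟨ caStep-correct f p q i ⟩
    cellsAfter (δ q (f (suc p))) f (suc p) q i
      ≡⟨ cong (λ s → cellsAfter (δ q s) f (suc p) q i) (tapeAt-head ls h rs (suc p)) ⟩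
    cellsAfter (δ q h) f (suc p) q i                      ≡⟨ byAction (δ q h) ⟩
    configCells (stepWith (δ q h) q ls h rs) (headPosAfter (δ q h) (suc p)) i
      ≡⟨ cong (λ c → configCells c (headPosAfter (δ q h) (suc p)) i) (step≡stepWith q ls h rs) ⟨
    configCells (step M (conf q ls h rs)) (headPosAfter (δ q h) (suc p)) i ∎
    where
    open ≡-Reasoning
    f = tapeAt ls h rs (suc p)
    byAction : ∀ a → cellsAfter a f (suc p) q i ≡ configCells (stepWith a q ls h rs) (headPosAfter a (suc p)) i
    byAction nothing = refl
    byAction (just (q′ , w , S)) = cong (_, headAt (suc p) q′ i) (sym (tapeAt-writeS ls h rs w (suc p) i))
    byAction (just (q′ , w , R)) rewrite shift-R ls w rs =
      cong (_, headAt (suc (suc p)) q′ i) (sym (tapeAt-writeR ls h rs w (suc p) i))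
    byAction (just (q′ , w , L)) rewrite shift-L ls w rs =
      cong (_, headAt p q′ i) (sym (tapeAt-writeL ls h rs w p i))

  caStepString : ℕ → Str → Str
  caStepString W = applyRule W caRule

  Represents : ℕ → Str → Config M → ℕ → Set
  Represents W str c P = ∀ i → i ≤ W → cellAt str i ≡ configCells c P i

  caStepString-represents : ∀ W str q ls h rs p → let c = conf q ls h rs ; P′ = headPosAfter (δ q h) (suc p) in
    Represents W str c (suc p) → P′ + rightLen (step M c) < W → Represents W (caStepString W str) (step M c) P′
  caStepString-represents W str q ls h rs p rep bound i i≤W with m≤n⇒m<n∨m≡n i≤W
  ... | inj₂ refl = trans (cellAt-applyRule-beyond i caRule str i ≤-refl) (sym (configCells-beyond _ _ i bound))
  ... | inj₁ i<W  = trans (cellAt-applyRule W caRule str i i<W)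
        (trans (cong₃ caRule (before i i<W) (rep i i≤W) (rep (suc i) i<W)) (caStep-simulates q ls h rs p i))
    where
    before : ∀ i → i < W → cellBefore str i ≡ cellsBefore (tapeAt ls h rs (suc p)) (suc p) q i
    before zero    _   = refl
    before (suc j) j<W = rep j (≤-trans (n≤1+n j) (<⇒≤ j<W))

  headPos-step-bounds : ∀ q ls h rs p → let P′ = headPosAfter (δ q h) (suc p) in
    p ≤ P′ × P′ + rightLen (step M (conf q ls h rs)) ≤ suc (suc p + length rs)
  headPos-step-bounds q ls h rs p rewrite step≡stepWith q ls h rs with δ q h
  ... | nothing           = n≤1+n p , n≤1+n (suc p + length rs)
  ... | just (q′ , w , S) = n≤1+n p , n≤1+n (suc p + length rs)
  ... | just (q′ , w , R) rewrite shift-R ls w rs =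
    ≤-trans (n≤1+n p) (n≤1+n (suc p)) , s≤s (+-monoʳ-≤ (suc p) (length-behead rs))
  ... | just (q′ , w , L) rewrite shift-L ls w rs =
    ≤-refl , ≤-trans (≤-reflexive (+-suc p (length rs))) (n≤1+n (suc p + length rs))

  run-suc : ∀ t c → run M (suc t) c ≡ step M (run M t c)
  run-suc zero    c = refl
  run-suc (suc t) c = run-suc t (step M c)

  record SimulatedAt (W P₀ K : ℕ) (str₀ : Str) (cfg₀ : Config M) (t : ℕ) : Set where
    field
      headPos       : ℕ
      represents    : Represents W (loop t (λ _ → caStepString W) str₀) (run M t cfg₀) headPos
      headPos-lower : P₀ ≤ headPos + t
      headPos-upper : headPos + rightLen (run M t cfg₀) ≤ P₀ + K + t

  -- The head moves at most one cell per step: started at P₀ > T it stays positive for T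
  -- steps, and the visited tape stays below W.
  simulate-step : ∀ {W P₀ K T str₀ cfg₀} t → T < P₀ → P₀ + K + T < W → suc t ≤ T →
    SimulatedAt W P₀ K str₀ cfg₀ t → SimulatedAt W P₀ K str₀ cfg₀ (suc t)
  simulate-step {W} {P₀} {K} {T} {str₀} {cfg₀} t T<P₀ bound t<T s =
    advance (headPos s) (run M t cfg₀) refl (represents s) (headPos-lower s) (headPos-upper s)
    where
    open SimulatedAt
    str = loop t (λ _ → caStepString W) str₀
    advance : ∀ P c → run M t cfg₀ ≡ c → Represents W str c P → P₀ ≤ P + t → P + rightLen c ≤ P₀ + K + t →
      SimulatedAt W P₀ K str₀ cfg₀ (suc t)
    advance zero c _ _ lower _ = ⊥-elim (<-irrefl refl (≤-<-trans lower (<-trans t<T T<P₀)))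
    advance (suc p) (conf q ls h rs) eq rep lower upper = record
      { headPos       = P′
      ; represents    = subst (λ c → Represents W (caStepString W str) c P′) (sym run≡)
                          (caStepString-represents W str q ls h rs p rep
                            (≤-<-trans upper′ (≤-<-trans (+-monoʳ-≤ (P₀ + K) t<T) bound)))
      ; headPos-lower = ≤-trans lower (≤-trans (≤-reflexive (sym (+-suc p t))) (+-monoˡ-≤ (suc t) (proj₁ bounds)))
      ; headPos-upper = subst (λ c → P′ + rightLen c ≤ P₀ + K + suc t) (sym run≡) upper′
      }
      where
      P′ = headPosAfter (δ q h) (suc p)
      bounds = headPos-step-bounds q ls h rs p
      run≡ : run M (suc t) cfg₀ ≡ step M (conf q ls h rs)
      run≡ = trans (run-suc t cfg₀) (cong (step M) eq)
      upper′ : P′ + rightLen (step M (conf q ls h rs)) ≤ P₀ + K + suc t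
      upper′ = ≤-trans (proj₂ bounds) (≤-trans (s≤s upper) (≤-reflexive (sym (+-suc (P₀ + K) t))))

  simulate : ∀ {W P₀ K T str₀ cfg₀} → Represents W str₀ cfg₀ P₀ → rightLen cfg₀ ≤ K → T < P₀ → P₀ + K + T < W →
    ∀ t → t ≤ T → SimulatedAt W P₀ K str₀ cfg₀ t
  simulate {P₀ = P₀} {K} rep₀ len≤K T<P₀ bound zero _ = record
    { headPos       = P₀
    ; represents    = rep₀
    ; headPos-lower = ≤-reflexive (sym (+-identityʳ P₀))
    ; headPos-upper = ≤-trans (+-monoʳ-≤ P₀ len≤K) (≤-reflexive (sym (+-identityʳ (P₀ + K))))
    }
  simulate rep₀ len≤K T<P₀ bound (suc t) t<T =
    simulate-step t T<P₀ bound t<T (simulate rep₀ len≤K T<P₀ bound t (≤-trans (n≤1+n t) t<T))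

  consBit : Sym M → Str → Str
  consBit (suc zero)       v = 𝟎 ∷ v
  consBit (suc (suc zero)) v = 𝟏 ∷ v
  consBit _                v = []

  bitsFrom : (ℕ → Sym M) → ℕ → Str
  bitsFrom f zero    = []
  bitsFrom f (suc n) = consBit (f 0) (bitsFrom (f ∘ suc) n)

  bitsFrom-cong : ∀ n {f g} → (∀ j → f j ≡ g j) → bitsFrom f n ≡ bitsFrom g n
  bitsFrom-cong zero    f≗g = refl
  bitsFrom-cong (suc n) f≗g = cong₂ consBit (f≗g 0) (bitsFrom-cong n (f≗g ∘ suc))

  bitsFrom-symAt : ∀ xs n → length xs ≤ n → bitsFrom (symAt xs) n ≡ readBits M xs
  bitsFrom-symAt []                     zero    _         = refl
  bitsFrom-symAt []                     (suc n) _         = refl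
  bitsFrom-symAt (zero ∷ xs)            (suc n) _         = refl
  bitsFrom-symAt (suc zero ∷ xs)        (suc n) (s≤s l≤n) = cong (𝟎 ∷_) (bitsFrom-symAt xs n l≤n)
  bitsFrom-symAt (suc (suc zero) ∷ xs)  (suc n) (s≤s l≤n) = cong (𝟏 ∷_) (bitsFrom-symAt xs n l≤n)
  bitsFrom-symAt (suc (suc (suc _)) ∷ xs) (suc n) _       = refl

  isHead : Maybe (Fin Q) → Bit
  isHead nothing  = false
  isHead (just _) = true

  scanLeaf : Cell → Leaf
  scanLeaf (suc zero , m)       = isHead m ∷ 𝟎 ∷ [] , dacc
  scanLeaf (suc (suc zero) , m) = isHead m ∷ 𝟏 ∷ [] , dacc
  scanLeaf (_ , m)              = isHead m ∷ [] , none

  scanLeaf-correct : ∀ s m a → leafS (scanLeaf (s , m)) a ≡ isHead m ∷ consBit s (sem-d a)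
  scanLeaf-correct zero                 m a = refl
  scanLeaf-correct (suc zero)           m a = refl
  scanLeaf-correct (suc (suc zero))     m a = refl
  scanLeaf-correct (suc (suc (suc _)))  m a = refl

  -- Scanning right to left, the accumulator is  𝟎 ∷ (maximal bit string from the
  -- current cell on)  until the head cell is met, and then stays  𝟏 ∷ output.
  scanStep : Cell → Str → Str
  scanStep c a = sem-If (sem-t 𝟏 a) a (leafS (scanLeaf c) a)

  scan : ℕ → (ℕ → Cell) → Str
  scan W cells = loop W (λ p → scanStep (cells (W ∸ suc p))) (𝟎 ∷ [])

  ScanInvariant : (ℕ → Sym M) → ℕ → ℕ → ℕ → Str → Set
  ScanInvariant τ W P k a =
    (W ∸ k ≤ P × a ≡ 𝟏 ∷ bitsFrom (λ j → τ (P + j)) (W ∸ P)) ⊎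
    (P < W ∸ k × a ≡ 𝟎 ∷ bitsFrom (λ j → τ (W ∸ k + j)) k)

  module _ (ls : List (Sym M)) (h : Sym M) (rs : List (Sym M)) (q : Fin Q) (P W : ℕ)
           (cells : ℕ → Cell) (cells≡ : ∀ i → i < W → cells i ≡ cellsOf (tapeAt ls h rs P) P q i) where

    private
      τ = tapeAt ls h rs P

    scanInvariant-step : ∀ k → k < W → ∀ {a} → ScanInvariant τ W P k a →
      ScanInvariant τ W P (suc k) (scanStep (cells (W ∸ suc k)) a)
    scanInvariant-step k k<W (inj₁ (W∸k≤P , refl)) = inj₁ (≤-trans (∸-monoʳ-≤ W (n≤1+n k)) W∸k≤P , refl)
    scanInvariant-step k k<W (inj₂ (P<W∸k , refl)) rewrite cells≡ (W ∸ suc k) (∸-monoʳ-< z<s k<W) =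
      subst (ScanInvariant τ W P (suc k)) (sym (scanLeaf-correct (τ i) (headAt P q i) (𝟎 ∷ X)))
        (byHeadPosition (m≤n⇒m<n∨m≡n (≤-pred (subst (P <_) W∸k≡ P<W∸k))))
      where
      i = W ∸ suc k
      W∸k≡ : W ∸ k ≡ suc i
      W∸k≡ = ∸-suc k<W
      X = bitsFrom (λ j → τ (W ∸ k + j)) k
      bits≡ : consBit (τ i) X ≡ bitsFrom (λ j → τ (i + j)) (suc k)
      bits≡ = cong₂ consBit (cong τ (sym (+-identityʳ i)))
                (bitsFrom-cong k (λ j → cong τ (trans (cong (_+ j) W∸k≡) (sym (+-suc i j)))))
      byHeadPosition : P < i ⊎ P ≡ i → ScanInvariant τ W P (suc k) (isHead (headAt P q i) ∷ consBit (τ i) X)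
      byHeadPosition (inj₁ P<i) = inj₂ (P<i , cong₂ _∷_ (cong isHead (headAt-beyond P q i P<i)) bits≡)
      byHeadPosition (inj₂ refl) = inj₁ (≤-refl ,
        cong₂ _∷_ (cong (λ b → isHead (if b then just q else nothing)) (≡ᵇ-refl P))
                  (trans bits≡ (cong (bitsFrom (λ j → τ (P + j))) (sym (m∸[m∸n]≡n k<W)))))

    scanInvariant : P < W → ∀ k → k ≤ W →
      ScanInvariant τ W P k (loop k (λ p → scanStep (cells (W ∸ suc p))) (𝟎 ∷ []))
    scanInvariant P<W zero    _   = inj₂ (P<W , refl)
    scanInvariant P<W (suc k) k<W = scanInvariant-step k k<W (scanInvariant P<W k (<⇒≤ k<W))

    scan-output : P + length rs < W → sem-d (scan W cells) ≡ readBits M (h ∷ rs)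
    scan-output lt with scanInvariant (≤-<-trans (m≤m+n P (length rs)) lt) W ≤-refl
    ... | inj₁ (_ , a≡) = trans (cong sem-d a≡)
      (trans (bitsFrom-cong (W ∸ P) (tapeAt-fromHead ls h rs P))
             (bitsFrom-symAt (h ∷ rs) (W ∸ P) (m+n<o⇒n<o∸m P lt)))
    ... | inj₂ (P<W∸W , _) = ⊥-elim (<-irrefl refl (≤-<-trans z≤n (subst (P <_) (n∸n≡0 W) P<W∸W)))

-- The simulation runs T = c·A steps on a tape of K input cells, with the head starting at
-- T + 1; the automaton's window has W = (2c + ℓ + 2)·N·A cells, N > n the input size.
tapeBound : ∀ c ℓ n K A N → K ≤ n + ℓ → suc n ≤ N → 1 ≤ A →
  suc (c * A) + K + c * A < (c + c + ℓ + 2) * (N * A)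
tapeBound c ℓ n K A N K≤ n<N 1≤A = begin-strict
  suc (c * A) + K + c * A                 <⟨ s≤s (+-monoˡ-≤ (c * A) (+-monoʳ-≤ (suc (c * A)) K≤)) ⟩
  suc (suc (c * A) + (n + ℓ) + c * A)     ≡⟨ regroup c A n ℓ ⟩
  c * A + c * A + ℓ * 1 + (n + 2)         ≤⟨ +-mono-≤ (+-mono-≤ (+-mono-≤ (*-monoʳ-≤ c A≤NA) (*-monoʳ-≤ c A≤NA))
                                                                 (*-monoʳ-≤ ℓ 1≤NA))
                                                      n+2≤ ⟩
  c * NA + c * NA + ℓ * NA + 2 * NA       ≡⟨ collect c ℓ NA ⟩
  (c + c + ℓ + 2) * NA                    ∎
  where
  open ≤-Reasoning
  NA = N * A
  regroup : ∀ c A n ℓ → suc (suc (c * A) + (n + ℓ) + c * A) ≡ c * A + c * A + ℓ * 1 + (n + 2)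
  regroup = solve-∀
  collect : ∀ c ℓ X → c * X + c * X + ℓ * X + 2 * X ≡ (c + c + ℓ + 2) * X
  collect = solve-∀
  1≤N : 1 ≤ N
  1≤N = ≤-trans (s≤s z≤n) n<N
  A≤NA : A ≤ NA
  A≤NA = ≤-trans (≤-reflexive (sym (*-identityˡ A))) (*-monoˡ-≤ A 1≤N)
  N≤NA : N ≤ NA
  N≤NA = ≤-trans (≤-reflexive (sym (*-identityʳ N))) (*-monoʳ-≤ N 1≤A)
  1≤NA : 1 ≤ NA
  1≤NA = ≤-trans 1≤A A≤NA
  n+2≤ : n + 2 ≤ 2 * NA
  n+2≤ = begin
    n + 2         ≡⟨ +-comm n 2 ⟩
    suc (suc n)   ≤⟨ +-mono-≤ 1≤N n<N ⟩
    N + N         ≤⟨ +-mono-≤ N≤NA N≤NA ⟩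
    NA + NA       ≡⟨ cong (NA +_) (sym (+-identityʳ NA)) ⟩
    2 * NA        ∎

-- The automaton as BCL loops

module Compile (ℓ : ℕ) (M : TM) where
  open TM M
  open Simulation M
  open Loops ℓ width public

  blankCode : Str
  blankCode = encodeCell blankCell

  drop-nextCell : ∀ p (C : Str) → drop width (drop (width * p) C) ≡ drop (width * suc p) C
  drop-nextCell p C = begin
    drop width (drop (width * p) C) ≡⟨ drop-drop (width * p) width C ⟩
    drop (width * p + width) C      ≡⟨ cong (λ k → drop k C) (+-comm (width * p) width) ⟩
    drop (width + width * p) C      ≡⟨ cong (λ k → drop k C) (*-suc width p) ⟨
    drop (width * suc p) C          ∎
    where open ≡-Reasoning

  threeCells : Vec Bool (width + (width + width)) → Cell × Cell × Cell
  threeCells v = decodeCell (proj₁ lcr) , decodeCell (proj₁ (splitVec width (proj₂ lcr)))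
                                        , decodeCell (proj₂ (splitVec width (proj₂ lcr)))
    where lcr = splitVec width v

  threeCells-bitsVec : ∀ C p →
    threeCells (bitsVec (width + (width + width)) (drop (width * p) C))
      ≡ (cellAt C p , cellAt C (suc p) , cellAt C (suc (suc p)))
  threeCells-bitsVec C p
    rewrite splitVec-bitsVec width (width + width) (drop (width * p) C)
          | splitVec-bitsVec width width (drop width (drop (width * p) C))
          | drop-nextCell p C | drop-nextCell (suc p) C = refl

  rebuildLeaf : Rule → Vec Bool (width + (width + width)) → Leaf
  rebuildLeaf g v = encodeCell (applyTo (threeCells v)) , acc
    where
    applyTo : Cell × Cell × Cell → Cell
    applyTo (l , c , r) = g l c r

  rebuildLeaf-correct : ∀ g C p a →
    leafS (rebuildLeaf g (bitsVec (width + (width + width)) (drop (width * p) C))) a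
      ≡ encodeCell (neighbourhood g C p) ++ a
  rebuildLeaf-correct g C p a =
    cong (λ (l , c , r) → encodeCell (g l c r) ++ a) (threeCells-bitsVec C p)

  rebuildE : Rule → List Factor → Exp → Exp
  rebuildE g Fs x =
    letE 1 (prefixE blankCode x) (letE 0 (const []) (loopE Fs (decideE (width + (width + width)) 0 (rebuildLeaf g))))

  ⊢rebuildE : ∀ g Fs {Γ x} → ArgsNorm Γ → Γ ⊢ x ∶ ` safe → Γ ⊢ rebuildE g Fs x ∶ ` safe
  ⊢rebuildE g Fs g↓ D =
    ⊢letE (⊢prefixE blankCode D)
      (⊢letE ty-const (⊢loopE Fs (⊢decideE (width + (width + width)) 0 (rebuildLeaf g)) (g↓ , refl , refl)))

  eval-rebuildE : ∀ g Fs {Γ x} (g↓ : ArgsNorm Γ) (D : Γ ⊢ x ∶ ` safe) ρ →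
    eval (⊢rebuildE g Fs g↓ D) ρ ≡ rebuild (count Fs (lengths ρ)) g (eval D ρ)
  eval-rebuildE g Fs {Γ} g↓ D ρ = trans
    (eval-loopE Fs (⊢decideE n 0 (rebuildLeaf g)) (λ _ v → leafS (rebuildLeaf g (bitsVec n v)))
                (eval-decideE n 0 (rebuildLeaf g)) {(Γ ,, 1 ∶ safe) ,, 0 ∶ safe} (g↓ , refl , refl) ρ′)
    (loop-cong (count Fs (lengths ρ)) refl (λ p a _ → trans
      (cong (λ u → leafS (rebuildLeaf g (bitsVec n (drop (width * p) u))) a) (eval-prefixE blankCode D ρ))
      (rebuildLeaf-correct g (blankCode ++ eval D ρ) p a)))
    where
    n = width + (width + width)
    ρ′ = (ρ [ 1 ↦ eval (⊢prefixE blankCode D) ρ ]) [ 0 ↦ [] ]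

  scanBody : Exp
  scanBody = If t₁ (var 0) then var 0 else decideE width width (scanLeaf ∘ decodeCell)

  ⊢scanBody : ⊢Body scanBody
  ⊢scanBody g@(_ , Γ0 , _) =
    ⊢If (ty-t₁ (ty-var Γ0)) (ty-var Γ0) (⊢decideE width width (scanLeaf ∘ decodeCell) g)

  scanBody-denotes : BodyDenotes ⊢scanBody (λ _ v → scanStep (decodeCell (bitsVec width (drop width v))))
  scanBody-denotes g ρ =
    cong (sem-If (sem-t 𝟏 (ρ 0)) (ρ 0)) (eval-decideE width width (scanLeaf ∘ decodeCell) g ρ)

  scanE : List Factor → Exp → Exp
  scanE Fs x = letE 1 (prefixE blankCode x) (letE 0 (const (𝟎 ∷ [])) (loopE Fs scanBody))

  ⊢scanE : ∀ Fs {Γ x} → ArgsNorm Γ → Γ ⊢ x ∶ ` safe → Γ ⊢ scanE Fs x ∶ ` safe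
  ⊢scanE Fs g↓ D = ⊢letE (⊢prefixE blankCode D) (⊢letE ty-const (⊢loopE Fs ⊢scanBody (g↓ , refl , refl)))

  eval-scanE : ∀ Fs {Γ x} (g↓ : ArgsNorm Γ) (D : Γ ⊢ x ∶ ` safe) ρ →
    eval (⊢scanE Fs g↓ D) ρ ≡ loop (count Fs (lengths ρ)) (λ p → scanStep (cellAt (eval D ρ) p)) (𝟎 ∷ [])
  eval-scanE Fs {Γ} g↓ D ρ = trans
    (eval-loopE Fs ⊢scanBody (λ _ v → scanStep (decodeCell (bitsVec width (drop width v)))) scanBody-denotes
                {(Γ ,, 1 ∶ safe) ,, 0 ∶ safe} (g↓ , refl , refl) ρ′)
    (loop-cong (count Fs (lengths ρ)) refl (λ p a _ → cong (λ c → scanStep c a) (begin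
      decodeCell (bitsVec width (drop width (drop (width * p) (eval (⊢prefixE blankCode D) ρ))))
        ≡⟨ cong (λ u → decodeCell (bitsVec width (drop width (drop (width * p) u))))
                (eval-prefixE blankCode D ρ) ⟩
      decodeCell (bitsVec width (drop width (drop (width * p) (blankCode ++ eval D ρ))))
        ≡⟨ cong (decodeCell ∘ bitsVec width) (drop-nextCell p (blankCode ++ eval D ρ)) ⟩
      cellAt (blankCode ++ eval D ρ) (suc p)
        ≡⟨ cellAt-suc blankCell (eval D ρ) p ⟩
      cellAt (eval D ρ) p ∎)))
    where
    open ≡-Reasoning
    ρ′ = (ρ [ 1 ↦ eval (⊢prefixE blankCode D) ρ ]) [ 0 ↦ 𝟎 ∷ [] ]

  -- Reversing first makes the left-to-right loop scan the cells from right to left.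
  outputE : List Factor → Exp → Exp
  outputE Fs x = d (scanE Fs (rebuildE centre Fs x))

  ⊢outputE : ∀ Fs {Γ x} → ArgsNorm Γ → Γ ⊢ x ∶ ` safe → Γ ⊢ outputE Fs x ∶ ` safe
  ⊢outputE Fs g↓ D = ty-d (⊢scanE Fs g↓ (⊢rebuildE centre Fs g↓ D))

  eval-outputE : ∀ Fs {Γ x} (g↓ : ArgsNorm Γ) (D : Γ ⊢ x ∶ ` safe) ρ →
    eval (⊢outputE Fs g↓ D) ρ ≡ sem-d (scan (count Fs (lengths ρ)) (cellAt (eval D ρ)))
  eval-outputE Fs g↓ D ρ = cong sem-d (trans (eval-scanE Fs g↓ (⊢rebuildE centre Fs g↓ D) ρ)
    (loop-cong W refl (λ p a p<W → cong (λ c → scanStep c a) (begin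
      cellAt (eval (⊢rebuildE centre Fs g↓ D) ρ) p
        ≡⟨ cong (λ u → cellAt u p) (eval-rebuildE centre Fs g↓ D ρ) ⟩
      cellAt (rebuild W centre X) p
        ≡⟨ cellAt-writeCells W (neighbourhood centre (blankCode ++ X)) p p<W ⟩
      cellAt (blankCode ++ X) (suc (W ∸ suc p))       ≡⟨ cellAt-suc blankCell X (W ∸ suc p) ⟩
      cellAt X (W ∸ suc p)                           ∎))))
    where
    open ≡-Reasoning
    W = count Fs (lengths ρ)
    X = eval D ρ

  symCode : Sym M → Str
  symCode s = encodeCell (s , nothing)

  inputCells : List (Sym M) → Str
  inputCells []       = []
  inputCells (s ∷ ss) = symCode s ++ inputCells ss

  inputCells-++ : ∀ ss ts → inputCells (ss ++ ts) ≡ inputCells ss ++ inputCells ts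
  inputCells-++ []       ts = refl
  inputCells-++ (s ∷ ss) ts =
    trans (cong (symCode s ++_) (inputCells-++ ss ts)) (sym (++-assoc (symCode s) (inputCells ss) (inputCells ts)))

  cellAt-inputCells : ∀ ss j → cellAt (inputCells ss) j ≡ (symAt ss j , nothing)
  cellAt-inputCells []       j       = cellAt-[] j
  cellAt-inputCells (s ∷ ss) zero    = cellAt-head (s , nothing) (inputCells ss)
  cellAt-inputCells (s ∷ ss) (suc j) = trans (cellAt-suc (s , nothing) (inputCells ss) j) (cellAt-inputCells ss j)

  startCode : Vec Bool Q
  startCode = unary (fromMaybe (just start))

  -- Overwrites the head field of the first cell with the start state.
  markFirst : Str → Str
  markFirst s = toList startCode ++ drop Q s

  markFirst-symCode : ∀ s rest → markFirst (symCode s ++ rest) ≡ encodeCell (s , just start) ++ rest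
  markFirst-symCode s rest = begin
    toList startCode ++ drop Q (toList (zeros Q Vec.++ unary s) ++ rest)
      ≡⟨ cong (λ u → toList startCode ++ drop Q (u ++ rest)) (toList-++ (zeros Q) (unary s)) ⟩
    toList startCode ++ drop Q ((toList (zeros Q) ++ toList (unary s)) ++ rest)
      ≡⟨ cong (λ u → toList startCode ++ drop Q u) (++-assoc (toList (zeros Q)) (toList (unary s)) rest) ⟩
    toList startCode ++ drop Q (toList (zeros Q) ++ toList (unary s) ++ rest)
      ≡⟨ cong (toList startCode ++_) (drop-toList-++ (zeros Q) (toList (unary s) ++ rest)) ⟩
    toList startCode ++ toList (unary s) ++ rest
      ≡⟨ ++-assoc (toList startCode) (toList (unary s)) rest ⟨
    (toList startCode ++ toList (unary s)) ++ rest
      ≡⟨ cong (_++ rest) (toList-++ startCode (unary s)) ⟨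
    toList (startCode Vec.++ unary s) ++ rest ∎
    where open ≡-Reasoning

  startConfig : List (Sym M) → Config M
  startConfig []       = conf start [] (blank M) []
  startConfig (s ∷ ss) = conf start [] s ss

  initConfig≡startConfig : ∀ {m} (xs : Vec Str m) → initConfig M xs ≡ startConfig (encInputs M xs)
  initConfig≡startConfig xs with encInputs M xs
  ... | []     = refl
  ... | _ ∷ _  = refl

  startCode-short : ∀ j → length (toList startCode ++ []) ≤ width * suc j
  startCode-short j = begin
    length (toList startCode ++ []) ≡⟨ cong length (++-identityʳ (toList startCode)) ⟩
    length (toList startCode)       ≡⟨ length-toList startCode ⟩
    Q                               ≤⟨ m≤m+n Q (3 + extra) ⟩
    width                           ≤⟨ m≤m*n width (suc j) ⟩
    width * suc j                   ∎
    where open ≤-Reasoning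

  cellAt-markFirst : ∀ ss j → cellAt (markFirst (inputCells ss)) j ≡ configCells (startConfig ss) 0 j
  cellAt-markFirst (s ∷ ss) zero =
    trans (cong (λ u → cellAt u 0) (markFirst-symCode s (inputCells ss)))
          (cellAt-head (s , just start) (inputCells ss))
  cellAt-markFirst (s ∷ ss) (suc j) = trans (cong (λ u → cellAt u (suc j)) (markFirst-symCode s (inputCells ss)))
    (trans (cellAt-suc (s , just start) (inputCells ss) j) (cellAt-inputCells ss j))
  cellAt-markFirst [] zero
    rewrite *-zeroʳ width | drop-[] {A = Bit} Q | bitsVec-toList-++ startCode (3 + extra) []
          | bitsVec-[] (3 + extra) | splitVec-++ startCode (zeros (3 + extra))
          | fromUnary-unary (fromMaybe (just start)) = refl
  cellAt-markFirst [] (suc j)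
    rewrite drop-[] {A = Bit} Q | drop-all (width * suc j) (toList startCode ++ []) (startCode-short j)
          | bitsVec-[] width = decodeCell-zeros

  padLeft : ℕ → Str → Str
  padLeft n s = loop n (λ _ → blankCode ++_) s

  cellAt-initialTape : ∀ ss n i →
    cellAt (padLeft n (markFirst (inputCells ss))) i ≡ configCells (startConfig ss) n i
  cellAt-initialTape ss       zero    i       = cellAt-markFirst ss i
  cellAt-initialTape []       (suc n) zero    = cellAt-head blankCell _
  cellAt-initialTape (s ∷ ss) (suc n) zero    = cellAt-head blankCell _
  cellAt-initialTape []       (suc n) (suc i) = trans (cellAt-suc blankCell _ i) (cellAt-initialTape [] n i)
  cellAt-initialTape (s ∷ ss) (suc n) (suc i) = trans (cellAt-suc blankCell _ i) (cellAt-initialTape (s ∷ ss) n i)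

  rightLen-startConfig : ∀ ss → rightLen (startConfig ss) ≤ length ss
  rightLen-startConfig []       = z≤n
  rightLen-startConfig (s ∷ ss) = n≤1+n (length ss)

  encodeArgE : Fin ℓ → Exp → Exp
  encodeArgE i rest = letE 4 rest (app (prn (lam 7 (lam 8
    (If var 7 then (If t₁ (var 7) then prefixE (symCode (sym1 M)) (var 8) else prefixE (symCode (sym0 M)) (var 8))
              else var 4)))) (var (argVar i)))

  ⊢encodeArgE : ∀ i {Γ rest} → ArgsNorm Γ → Γ ⊢ rest ∶ ` safe → Γ ⊢ encodeArgE i rest ∶ ` safe
  ⊢encodeArgE i g↓ D = ⊢letE D (ty-app isUnion-self (ty-prn (ty-lam (ty-lam
    (⊢If (norm⇒safe (ty-var refl))
         (⊢If (ty-t₁ (norm⇒safe (ty-var refl)))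
              (⊢prefixE (symCode (sym1 M)) (ty-var refl)) (⊢prefixE (symCode (sym0 M)) (ty-var refl)))
         (ty-var refl))))) (ty-var (g↓ i)))

  sem-prn-inputCells : ∀ (f : Str → Str → Str) rest → (∀ w → f [] w ≡ rest) →
    (∀ v w → f (𝟏 ∷ v) w ≡ symCode (sym1 M) ++ w) → (∀ v w → f (𝟎 ∷ v) w ≡ symCode (sym0 M) ++ w) →
    ∀ x → sem-prn f x ≡ inputCells (encStr M x) ++ rest
  sem-prn-inputCells f rest f-ε f-𝟏 f-𝟎 [] = f-ε []
  sem-prn-inputCells f rest f-ε f-𝟏 f-𝟎 (true ∷ x) =
    trans (f-𝟏 x _) (trans (cong (symCode (sym1 M) ++_) (sem-prn-inputCells f rest f-ε f-𝟏 f-𝟎 x))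
      (sym (++-assoc (symCode (sym1 M)) (inputCells (encStr M x)) rest)))
  sem-prn-inputCells f rest f-ε f-𝟏 f-𝟎 (false ∷ x) =
    trans (f-𝟎 x _) (trans (cong (symCode (sym0 M) ++_) (sem-prn-inputCells f rest f-ε f-𝟏 f-𝟎 x))
      (sym (++-assoc (symCode (sym0 M)) (inputCells (encStr M x)) rest)))

  eval-encodeArgE : ∀ i {Γ rest} (g↓ : ArgsNorm Γ) (D : Γ ⊢ rest ∶ ` safe) ρ →
    eval (⊢encodeArgE i g↓ D) ρ ≡ inputCells (encStr M (ρ (argVar i))) ++ eval D ρ
  eval-encodeArgE i {Γ} g↓ D ρ = sem-prn-inputCells _ (eval D ρ) (λ _ → refl)
    (λ v w → eval-prefixE (symCode (sym1 M)) {Γ′} (ty-var refl) (ρ′ (𝟏 ∷ v) w))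
    (λ v w → eval-prefixE (symCode (sym0 M)) {Γ′} (ty-var refl) (ρ′ (𝟎 ∷ v) w))
    (ρ (argVar i))
    where
    Γ′ = ((Γ ,, 4 ∶ safe) ,, 7 ∶ norm) ,, 8 ∶ safe
    ρ′ : Str → Str → Env
    ρ′ v w = ((ρ [ 4 ↦ eval D ρ ]) [ 7 ↦ v ]) [ 8 ↦ w ]

  encodeArgsE : ∀ m → (Fin m → Fin ℓ) → Exp
  encodeArgsE zero          arg# = const []
  encodeArgsE (suc zero)    arg# = encodeArgE (arg# zero) (const [])
  encodeArgsE (suc (suc m)) arg# =
    encodeArgE (arg# zero) (prefixE (symCode (sep M)) (encodeArgsE (suc m) (arg# ∘ suc)))

  ⊢encodeArgsE : ∀ m arg# {Γ} → ArgsNorm Γ → Γ ⊢ encodeArgsE m arg# ∶ ` safe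
  ⊢encodeArgsE zero          arg# g↓ = ty-const
  ⊢encodeArgsE (suc zero)    arg# g↓ = ⊢encodeArgE (arg# zero) g↓ ty-const
  ⊢encodeArgsE (suc (suc m)) arg# {Γ} g↓ =
    ⊢encodeArgE (arg# zero) g↓ (⊢prefixE (symCode (sep M)) (⊢encodeArgsE (suc m) (arg# ∘ suc) {Γ} g↓))

  eval-encodeArgsE : ∀ m arg# {Γ} (g↓ : ArgsNorm Γ) ρ (xs : Vec Str m) → (∀ j → ρ (argVar (arg# j)) ≡ lookup xs j) →
    eval (⊢encodeArgsE m arg# {Γ} g↓) ρ ≡ inputCells (encInputs M xs)
  eval-encodeArgsE zero          arg# g↓ ρ []           ρ≡ = refl
  eval-encodeArgsE (suc zero)    arg# g↓ ρ (x ∷ [])     ρ≡ =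
    trans (eval-encodeArgE (arg# zero) g↓ ty-const ρ)
      (trans (++-identityʳ _) (cong (inputCells ∘ encStr M) (ρ≡ zero)))
  eval-encodeArgsE (suc (suc m)) arg# {Γ} g↓ ρ (x ∷ y ∷ xs) ρ≡ = begin
    eval (⊢encodeArgsE (suc (suc m)) arg# {Γ} g↓) ρ
      ≡⟨ eval-encodeArgE (arg# zero) {Γ} g↓ (⊢prefixE (symCode (sep M)) rest) ρ ⟩
    inputCells (encStr M (ρ (argVar (arg# zero)))) ++ eval (⊢prefixE (symCode (sep M)) rest) ρ
      ≡⟨ cong₂ (λ a b → inputCells (encStr M a) ++ b) (ρ≡ zero)
           (trans (eval-prefixE (symCode (sep M)) rest ρ)
                  (cong (symCode (sep M) ++_)
                        (eval-encodeArgsE (suc m) (arg# ∘ suc) {Γ} g↓ ρ (y ∷ xs) (ρ≡ ∘ suc)))) ⟩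
    inputCells (encStr M x) ++ inputCells (sep M ∷ encInputs M (y ∷ xs))
      ≡⟨ inputCells-++ (encStr M x) (sep M ∷ encInputs M (y ∷ xs)) ⟨
    inputCells (encInputs M (x ∷ y ∷ xs)) ∎
    where
    open ≡-Reasoning
    rest = ⊢encodeArgsE (suc m) (arg# ∘ suc) {Γ} g↓

  length-encStr : ∀ x → length (encStr M x) ≡ length x
  length-encStr []          = refl
  length-encStr (false ∷ x) = cong suc (length-encStr x)
  length-encStr (true ∷ x)  = cong suc (length-encStr x)

  length-encInputs : ∀ {m} (xs : Vec Str m) → length (encInputs M xs) ≤ totalLength xs + m
  length-encInputs []       = z≤n
  length-encInputs (x ∷ []) = begin
    length (encStr M x) ≡⟨ length-encStr x ⟩
    length x            ≤⟨ m≤m+n (length x) 1 ⟩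
    length x + 1        ≡⟨ cong (_+ 1) (+-identityʳ (length x)) ⟨
    length x + 0 + 1    ∎
    where open ≤-Reasoning
  length-encInputs {suc (suc m)} (x ∷ y ∷ xs) = begin
    length (encStr M x ++ sep M ∷ encInputs M (y ∷ xs))   ≡⟨ length-++ (encStr M x) ⟩
    length (encStr M x) + suc (length (encInputs M (y ∷ xs))) ≡⟨ cong (_+ _) (length-encStr x) ⟩
    length x + suc (length (encInputs M (y ∷ xs)))        ≤⟨ +-monoʳ-≤ (length x) (s≤s (length-encInputs (y ∷ xs))) ⟩
    length x + suc (totalLength (y ∷ xs) + suc m)         ≡⟨ regroup (length x) (totalLength (y ∷ xs)) m ⟩
    length x + totalLength (y ∷ xs) + suc (suc m)         ∎
    where
    open ≤-Reasoning
    regroup : ∀ a t m → a + suc (t + suc m) ≡ a + t + suc (suc m)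
    regroup = solve-∀

  padBody : Exp
  padBody = prefixE blankCode (var 0)

  ⊢padBody : ⊢Body padBody
  ⊢padBody (_ , Γ0 , _) = ⊢prefixE blankCode (ty-var Γ0)

  padBody-denotes : BodyDenotes ⊢padBody (λ _ _ → blankCode ++_)
  padBody-denotes (_ , Γ0 , _) = eval-prefixE blankCode (ty-var Γ0)

  inputTapeE : Exp
  inputTapeE = prefixE (toList startCode) (dropE Q (encodeArgsE ℓ (λ i → i)))

  ⊢inputTapeE : ⊢Closed inputTapeE
  ⊢inputTapeE {Γ} g↓ = ⊢prefixE (toList startCode) (⊢dropE Q (⊢encodeArgsE ℓ (λ i → i) {Γ} g↓))

  eval-inputTapeE : ∀ {Γ} (g↓ : ArgsNorm Γ) ρ xs → ArgsAre ρ xs →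
    eval (⊢inputTapeE {Γ} g↓) ρ ≡ markFirst (inputCells (encInputs M xs))
  eval-inputTapeE {Γ} g↓ ρ xs ρ≡ = begin
    eval (⊢inputTapeE {Γ} g↓) ρ                       ≡⟨ eval-prefixE (toList startCode) (⊢dropE Q args) ρ ⟩
    toList startCode ++ eval (⊢dropE Q args) ρ        ≡⟨ cong (toList startCode ++_) (eval-dropE Q args ρ) ⟩
    toList startCode ++ drop Q (eval args ρ)          ≡⟨ cong (markFirst) (eval-encodeArgsE ℓ (λ i → i) {Γ} g↓ ρ xs ρ≡) ⟩
    markFirst (inputCells (encInputs M xs))           ∎
    where
    open ≡-Reasoning
    args = ⊢encodeArgsE ℓ (λ i → i) {Γ} g↓

  initialTape : ℕ → Vec Str ℓ → Str
  initialTape T xs = padLeft (suc T) (markFirst (inputCells (encInputs M xs)))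

  module Clocked (c k : ℕ) where

    E : ℕ
    E = c + c + ℓ + 2

    timeFactors widthFactors : List Factor
    timeFactors  = num c ∷ allArgs^ k
    widthFactors = num E ∷ allArgs^ (suc k)

    stepBody : Exp
    stepBody = rebuildE centre widthFactors (rebuildE caRule widthFactors (var 0))

    ⊢stepBody : ⊢Body stepBody
    ⊢stepBody (g↓ , Γ0 , _) =
      ⊢rebuildE centre widthFactors g↓ (⊢rebuildE caRule widthFactors g↓ (ty-var Γ0))

    stepBody-denotes : BodyDenotes ⊢stepBody (λ lz _ → caStepString (count widthFactors lz))
    stepBody-denotes (g↓ , Γ0 , _) ρ =
      trans (eval-rebuildE centre widthFactors g↓ (⊢rebuildE caRule widthFactors g↓ (ty-var Γ0)) ρ)
            (cong (rebuild (count widthFactors (lengths ρ)) centre) (eval-rebuildE caRule widthFactors g↓ (ty-var Γ0) ρ))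

    initialTapeE mainE : Exp
    initialTapeE = letE 0 inputTapeE (prefixE blankCode (loopE timeFactors padBody))
    mainE = letE 1 (const []) (letE 0 initialTapeE
              (letE 0 (loopE timeFactors stepBody) (outputE widthFactors (var 0))))

    ⊢initialTapeE : ∀ {Γ} → ArgsNorm Γ → Γ 1 ≡ just safe → Γ ⊢ initialTapeE ∶ ` safe
    ⊢initialTapeE g↓ Γ1 =
      ⊢letE (⊢inputTapeE g↓) (⊢prefixE blankCode (⊢loopE timeFactors ⊢padBody (g↓ , refl , Γ1)))

    ⊢mainE : ⊢Closed mainE
    ⊢mainE g↓ = ⊢letE ty-const (⊢letE (⊢initialTapeE g↓ refl)
      (⊢letE (⊢loopE timeFactors ⊢stepBody (g↓ , refl , refl)) (⊢outputE widthFactors g↓ (ty-var refl))))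

    eval-initialTapeE : ∀ {Γ} (g↓ : ArgsNorm Γ) Γ1 ρ xs → ArgsAre ρ xs →
      eval (⊢initialTapeE {Γ} g↓ Γ1) ρ ≡ initialTape (count timeFactors (lengths ρ)) xs
    eval-initialTapeE {Γ} g↓ Γ1 ρ xs ρ≡ = begin
      eval (⊢prefixE blankCode pads) ρ′
        ≡⟨ eval-prefixE blankCode pads ρ′ ⟩
      blankCode ++ eval pads ρ′
        ≡⟨ cong (blankCode ++_)
                (eval-loopE timeFactors ⊢padBody (λ _ _ → blankCode ++_) padBody-denotes (g↓ , refl , Γ1) ρ′) ⟩
      blankCode ++ padLeft T (eval (⊢inputTapeE {Γ} g↓) ρ)
        ≡⟨ cong (λ s → blankCode ++ padLeft T s) (eval-inputTapeE g↓ ρ xs ρ≡) ⟩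
      initialTape T xs ∎
      where
      open ≡-Reasoning
      T = count timeFactors (lengths ρ)
      ρ′ = ρ [ 0 ↦ eval (⊢inputTapeE {Γ} g↓) ρ ]
      pads = ⊢loopE timeFactors ⊢padBody {Γ ,, 0 ∶ safe} (g↓ , refl , Γ1)

    eval-mainE : ∀ {Γ} (g↓ : ArgsNorm Γ) ρ xs → ArgsAre ρ xs → let lz = lengths ρ in
      eval (⊢mainE {Γ} g↓) ρ ≡
        sem-d (scan (count widthFactors lz)
                    (cellAt (loop (count timeFactors lz) (λ _ → caStepString (count widthFactors lz))
                                  (initialTape (count timeFactors lz) xs))))
    eval-mainE {Γ} g↓ ρ xs ρ≡ = begin
      eval (⊢outputE widthFactors g↓ (ty-var refl)) ρ₃
        ≡⟨ eval-outputE widthFactors g↓ (ty-var refl) ρ₃ ⟩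
      sem-d (scan W (cellAt (eval steps ρ₂)))
        ≡⟨ cong (λ s → sem-d (scan W (cellAt s)))
             (eval-loopE timeFactors ⊢stepBody (λ lz _ → caStepString (count widthFactors lz)) stepBody-denotes
                         (g↓ , refl , refl) ρ₂) ⟩
      sem-d (scan W (cellAt (loop T (λ _ → caStepString W) (eval (⊢initialTapeE {Γ₁} g↓ refl) ρ₁))))
        ≡⟨ cong (λ s → sem-d (scan W (cellAt (loop T (λ _ → caStepString W) s))))
             (eval-initialTapeE g↓ refl ρ₁ xs ρ≡) ⟩
      sem-d (scan W (cellAt (loop T (λ _ → caStepString W) (initialTape T xs)))) ∎
      where
      open ≡-Reasoning
      W = count widthFactors (lengths ρ)
      T = count timeFactors (lengths ρ)
      Γ₁ = Γ ,, 1 ∶ safe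
      ρ₁ = ρ [ 1 ↦ [] ]
      ρ₂ = ρ₁ [ 0 ↦ eval (⊢initialTapeE {Γ₁} g↓ refl) ρ₁ ]
      steps = ⊢loopE timeFactors ⊢stepBody {Γ₁ ,, 0 ∶ safe} (g↓ , refl , refl)
      ρ₃ = ρ₂ [ 0 ↦ eval steps ρ₂ ]

    module _ (ρ : Env) (xs : Vec Str ℓ) (ρ≡ : ArgsAre ρ xs) where
      private
        lz = lengths ρ
        N = count allArgs lz
        A = count (allArgs^ k) lz
        T = count timeFactors lz
        W = count widthFactors lz
        K = length (encInputs M xs)

      input<N : suc (totalLength xs) ≤ N
      input<N = totalLength<count ℓ (λ i → i) lz xs (λ j → cong length (ρ≡ j))

      time-bound : c * suc (totalLength xs) ^ k ≤ T
      time-bound = *-monoʳ-≤ c (subst (_ ≤_) (sym (count-allArgs^ k lz)) (^-monoˡ-≤ k input<N))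

      window : suc T + K + T < W
      window = subst (λ w → suc T + K + T < E * w) (sym (count-++ allArgs (allArgs^ k) lz))
        (tapeBound c ℓ (totalLength xs) K A N (length-encInputs xs) input<N 1≤A)
        where
        1≤A : 1 ≤ A
        1≤A = subst (1 ≤_) (sym (count-allArgs^ k lz))
          (≤-trans (≤-reflexive (sym (^-zeroˡ k))) (^-monoˡ-≤ k (≤-trans (s≤s z≤n) input<N)))

      initialTape-represents : Represents W (initialTape T xs) (initConfig M xs) (suc T)
      initialTape-represents i _ = trans (cellAt-initialTape (encInputs M xs) (suc T) i)
        (cong (λ cfg → configCells cfg (suc T) i) (sym (initConfig≡startConfig xs)))

      simulation-output : sem-d (scan W (cellAt (loop T (λ _ → caStepString W) (initialTape T xs))))
                          ≡ output M (run M T (initConfig M xs))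
      simulation-output = atEnd (run M T (initConfig M xs)) refl
        where
        open SimulatedAt
        s = simulate initialTape-represents
              (subst (λ cfg → rightLen cfg ≤ K) (sym (initConfig≡startConfig xs)) (rightLen-startConfig (encInputs M xs)))
              ≤-refl window T ≤-refl
        atEnd : ∀ cfg → run M T (initConfig M xs) ≡ cfg →
          sem-d (scan W (cellAt (loop T (λ _ → caStepString W) (initialTape T xs)))) ≡ output M cfg
        atEnd (conf q ls h rs) run≡ = scan-output ls h rs q (headPos s) W _
          (λ i i<W → trans (represents s i (<⇒≤ i<W)) (cong (λ cfg → configCells cfg (headPos s) i) run≡))
          (≤-<-trans (subst (λ cfg → headPos s + rightLen cfg ≤ suc T + K + T) run≡ (headPos-upper s)) window)

    mainE-correct : ∀ {Γ} (g↓ : ArgsNorm Γ) ρ xs → ArgsAre ρ xs →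
      eval (⊢mainE {Γ} g↓) ρ ≡ output M (run M (count timeFactors (lengths ρ)) (initConfig M xs))
    mainE-correct g↓ ρ xs ρ≡ = trans (eval-mainE g↓ ρ xs ρ≡) (simulation-output ρ xs ρ≡)

module Halting (M : TM) where

  run-+ : ∀ a b c → run M (a + b) c ≡ run M b (run M a c)
  run-+ zero    b c = refl
  run-+ (suc a) b c = run-+ a b (step M c)

  step-halted : ∀ c → Halted M c → step M c ≡ c
  step-halted (conf q ls h rs) halted with TM.δ M q h | halted
  ... | nothing | _ = refl

  run-halted : ∀ c → Halted M c → ∀ t → run M t c ≡ c
  run-halted c halted zero    = refl
  run-halted c halted (suc t) = trans (cong (run M t) (step-halted c halted)) (run-halted c halted t)

  run-after-halt : ∀ {a b} c → a ≤ b → Halted M (run M a c) → run M b c ≡ run M a c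
  run-after-halt {a} {b} c a≤b halted = begin
    run M b c                   ≡⟨ cong (λ t → run M t c) (m+[n∸m]≡n a≤b) ⟨
    run M (a + (b ∸ a)) c       ≡⟨ run-+ a (b ∸ a) c ⟩
    run M (b ∸ a) (run M a c)   ≡⟨ run-halted (run M a c) halted (b ∸ a) ⟩
    run M a c                   ∎
    where open ≡-Reasoning

proposition3p3 : (ℓ : ℕ) (f : Vec Str ℓ → Str) → PolyTimeComputable f →
    Σ Exp λ e → Σ (∅ ⊢ e ∶ NormArrows ℓ) λ D →
      ∀ (xs : Vec Str ℓ) → applyAll ⟦ D ⟧₀ xs ≡ f xs
proposition3p3 zero    f _                = const (f []) , ty-const , λ { [] → refl }
proposition3p3 (suc l) f (M , c , k , fM) = argLams 0 (suc l) mainE , ⊢e , denotes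
  where
  open Compile (suc l) M
  open Clocked c k
  open Halting M
  ⊢e : ∅ ⊢ argLams 0 (suc l) mainE ∶ NormArrows (suc l)
  ⊢e = ⊢argLams 0 (suc l) (λ _ ()) refl ⊢mainE
  denotes : ∀ xs → applyAll ⟦ ⊢e ⟧₀ xs ≡ f xs
  denotes xs = applyAll-argLams 0 (suc l) (λ _ ()) refl ⊢mainE (λ ρ → ArgsAre ρ xs) (f xs) mainE-computes-f
    (λ _ → []) xs (bindArgs-lookup 0 (λ _ → []) xs)
    where
    mainE-computes-f : ∀ {Γ} (g↓ : ArgsNorm Γ) ρ → ArgsAre ρ xs → eval (⊢mainE {Γ} g↓) ρ ≡ f xs
    mainE-computes-f g↓ ρ ρ≡ = begin
      eval (⊢mainE g↓) ρ                                         ≡⟨ mainE-correct g↓ ρ xs ρ≡ ⟩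
      output M (run M (count timeFactors (lengths ρ)) (initConfig M xs))
        ≡⟨ cong (output M) (run-after-halt (initConfig M xs) (time-bound ρ xs ρ≡) (proj₁ (fM xs))) ⟩
      output M (run M (c * suc (totalLength xs) ^ k) (initConfig M xs)) ≡⟨ proj₂ (fM xs) ⟩
      f xs                                                       ∎
      where open ≡-Reasoning
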